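{- Let $(W,S)$ be any Coxeter system and $H\subseteq S$. Let $\mathcal S^H$ be the set of left multiplication partial matchings of $W^H$. Then $(W^H,\mathcal S^H)$ is a pircon system, and for each $x\in\{q,-1\}$ the family of Kazhdan--Lusztig $R^x$-polynomials of $(W^H,\mathcal S^H)$ satisfies the up-down symmetry.
   Context: $\ell$ is the length, $D_L(w)=\{s\in S:\ell(sw)<\ell(w)\}$, $W^H=\{w\in W: \ell(wh)>\ell(w)\ \forall h\in H\}$, ordered by Bruhat order; $[e,w]^H=\{u\in W^H:u\le w\}$. It is known that $W^H$ is a pircon (definitions below) with rank function $\ell$. For $w\in W^H\setminus\{e\}$ and $s\in D_L(w)$, the left multiplication partial matching $\lambda^H_s$ of $w$ is the map on $[e,w]^H$ given by $\lambda_s^H(u)=su$ if $su\in W^H$ and $\lambda_s^H(u)=u$ otherwise; $\mathcal S^H$ is the set of all these maps (each regarded as a map on the order ideal $[e,w]^H$). For elements of a poset, $x\lhd y$ means $y$ covers $x$; $P_{\le x}=\{y:y\le x\}$. A quasi special partial matching of a poset $P$ is an involution $M:P\to P$ with, for every $x$, $M(x)\lhd x$, $M(x)=x$ or $M(x)\rhd x$, and such that $x\lhd y$, $M(x)\ne y$ imply $M(x)<M(y)$. If $P$ is finite with maximum $\hat1_P$, a special partial matching is a quasi special partial matching with $M(\hat1_P)\lhd\hat1_P$. A pircon is a poset such that every $P_{\le x}$, $x$ non-minimal, is finite and admits a special partial matching (connected, graded, minimum $\hat0_P$). For quasi special partial matchings $M,N$ of $P_{\le w}$, each orbit $\mathcal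 O$ of $\langle M,N\rangle$ is an interval and either dihedral (isomorphic to a Bruhat interval in a rank-2 Coxeter group, no point fixed by $M$ or $N$) or chain-like (a chain whose minimum and maximum are each fixed by $M$ or $N$); $m(\mathcal O)$ is the rank of $\mathcal O$, plus $1$ if chain-like. $M,N$ are strictly coherent if $m(\mathcal O)\mid m(\langle M,N\rangle(w))$ for all orbits; special partial matchings of $w$ are coherent if joined by a chain of special partial matchings of $w$ with consecutive ones strictly coherent. A pircon system is a pair $(P,S)$ with $P$ a pircon and $S$ a set of quasi special partial matchings of order ideals of $P$ ("$M(v)$ defined" means $v$ in the domain) such that every $w\ne\hat0_P$ has some $M\in S$ with $M(w)$ defined and $M(w)\lhd w$, and whenever $M,N\in S$ have $M(w)\lhd w$, $N(w)\lhd w$, their restrictions to $P_{\le w}$ are coherent. $R^x$-polynomials of $(P,S)$ ($x\in\{q,-1\}$): choosing for each $w\ne\hat0_P$ some $M_w\in S$ with $M_w(w)\lhd w$, $\{R^x_{u,w}\}\subseteq\mathbb Z[q]$ is the unique family with $R^x_{u,w}=0$ if $u\not\le w$, $R^x_{w,w}=1$, and for $u\le w$: $R^x_{u,w}=R^x_{M_w(u),M_w(w)}$ if $M_w(u)\lhd u$; $=(q-1)R^x_{u,M_w(w)}+qR^x_{M_w(u),M_w(w)}$ if $M_w(u)\rhd u$; $=(q-1-x)R^x_{u,M_w(w)}$ if $M_w(u)=u$ (known to be independent of choices for a pircon system). Up-down symmetry: for all $M\in S$ and $u,w$ with $M(u),M(w)$ defined and $M(u)\rhd u$: $R^x_{u,w}=R^x_{M(u),M(w)}$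 if $M(w)\rhd w$; $R^x_{u,w}=(q-1)R^x_{M(u),w}+qR^x_{M(u),M(w)}$ if $M(w)\lhd w$; $R^x_{u,w}=(q-1-x)R^x_{M(u),w}$ if $M(w)=w$. -}

module Defs where

open import Level using (0ℓ)
open import Data.Nat as ℕ using (ℕ; zero; suc)
open import Data.Nat.Divisibility using (_∣_)
open import Data.Integer as ℤ using (ℤ; +_)
open import Data.List using (List; []; _∷_; _++_; length; replicate; concat; reverse; map)
open import Data.List.Relation.Unary.Any using (Any)
open import Data.Maybe using (Maybe; just)
open import Data.Product using (Σ; ∃; _×_; _,_; proj₁; proj₂)
open import Data.Sum using (_⊎_)
open import Data.Empty using (⊥)
open import Relation.Nullary using (¬_; Dec; yes; no)
open import Relation.Binary.PropositionalEquality using (_≡_)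
open import Relation.Binary.Structures using (IsPartialOrder)
open import Axiom.ExcludedMiddle using (ExcludedMiddle)

-- Polynomials in ℤ[q]: coefficient lists (constant term first),
-- compared coefficientwise (so trailing zeros are irrelevant).

Poly : Set
Poly = List ℤ

coeff : Poly → ℕ → ℤ
coeff []       _       = + 0
coeff (a ∷ p)  zero    = a
coeff (a ∷ p)  (suc n) = coeff p n

_≈P_ : Poly → Poly → Set
p ≈P r = ∀ n → coeff p n ≡ coeff r n

infixl 6 _+P_ _-P_
infixl 7 _*P_

_+P_ : Poly → Poly → Poly
[]      +P r       = r
(a ∷ p) +P []      = a ∷ p
(a ∷ p) +P (b ∷ r) = (a ℤ.+ b) ∷ (p +P r)

negP : Poly → Poly
negP = map (λ a → ℤ.- a)

_-P_ : Poly → Poly → Poly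
p -P r = p +P negP r

_*P_ : Poly → Poly → Poly
[]      *P r = []
(a ∷ p) *P r = map (a ℤ.*_) r +P (+ 0 ∷ (p *P r))

oneP : Poly
oneP = + 1 ∷ []

qP : Poly
qP = + 0 ∷ + 1 ∷ []

q-1 : Poly
q-1 = qP -P oneP

data Xval : Set where
  x=q x=-1 : Xval

xPoly : Xval → Poly
xPoly x=q  = qP
xPoly x=-1 = negP oneP

fixFactor : Xval → Poly
fixFactor x = q-1 -P xPoly x

module PosetTheory {A : Set} (_≈_ : A → A → Set) (_≤_ : A → A → Set) where

  _<ₚ_ : A → A → Set
  x <ₚ y = (x ≤ y) × ¬ (x ≈ y)

  _⋖_ : A → A → Set
  x ⋖ y = (x <ₚ y) × (∀ z → x <ₚ z → z <ₚ y → ⊥)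

  Minimal : A → Set
  Minimal x = ∀ y → y ≤ x → y ≈ x

  Below : A → A → Set
  Below w x = x ≤ w

  Finite : (A → Set) → Set
  Finite D = Σ (List A) λ xs → ∀ x → D x → Any (x ≈_) xs

  IsOrderIdeal : (A → Set) → Set
  IsOrderIdeal D = ∀ x y → D y → x ≤ y → D x

  -- quasi special partial matching with domain D (M is total on A,
  -- only its behaviour on D matters)
  record IsQSPM (D : A → Set) (M : A → A) : Set where
    field
      resp   : ∀ x y → D x → D y → x ≈ y → M x ≈ M y
      closed : ∀ x → D x → D (M x)
      invol  : ∀ x → D x → M (M x) ≈ x
      trich  : ∀ x → D x → (M x ⋖ x) ⊎ (M x ≈ x) ⊎ (x ⋖ M x)
      lift   : ∀ x y → D x → D y → x ⋖ y → ¬ (M x ≈ y) → M x <ₚ M y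

  IsSPM : A → (A → A) → Set
  IsSPM w M = IsQSPM (Below w) M × (M w ⋖ w)

  IsPircon : Set
  IsPircon = IsPartialOrder _≈_ _≤_
           × (Σ A λ b → ∀ x → b ≤ x)
           × (∀ x → ¬ Minimal x → Finite (Below x) × Σ (A → A) (IsSPM x))

  data Orb (M N : A → A) (x : A) : A → Set where
    here : ∀ {y} → y ≈ x → Orb M N x y
    viaM : ∀ {y z} → Orb M N x y → z ≈ M y → Orb M N x z
    viaN : ∀ {y z} → Orb M N x y → z ≈ N y → Orb M N x z

  data SatChain : A → A → ℕ → Set where
    done : ∀ {a b} → a ≈ b → SatChain a b zero
    step : ∀ {a c b r} → a ⋖ c → SatChain c b r → SatChain a b (suc r)

  IsChain : (A → Set) → Set
  IsChain O = ∀ y z → O y → O z → (y ≤ z) ⊎ (z ≤ y)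

  FixedBy : (M N : A → A) → A → Set
  FixedBy M N y = (M y ≈ y) ⊎ (N y ≈ y)

  -- orbit O of x is chain-like, with minimum a and maximum b
  ChainLike : (M N : A → A) → A → A → A → Set
  ChainLike M N x a b = IsChain (Orb M N x) × FixedBy M N a × FixedBy M N b

  -- OrbitM M N x k :  m(⟨M,N⟩(x)) = k
  -- (rank of the orbit, i.e. the length of a saturated chain from its
  --  minimum to its maximum, plus 1 if the orbit is chain-like)
  OrbitM : (M N : A → A) → A → ℕ → Set
  OrbitM M N x k =
    Σ A λ a → Σ A λ b → Σ ℕ λ r →
      Orb M N x a × Orb M N x b
      × (∀ y → Orb M N x y → (a ≤ y) × (y ≤ b))
      × SatChain a b r
      × ((ChainLike M N x a b × k ≡ suc r) ⊎ (¬ ChainLike M N x a b × k ≡ r))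

  StrictlyCoherent : A → (A → A) → (A → A) → Set
  StrictlyCoherent w M N =
    ∀ x → x ≤ w → Σ ℕ λ k → Σ ℕ λ k' → OrbitM M N x k × OrbitM M N w k' × (k ∣ k')

  data Coherent (w : A) : (A → A) → (A → A) → Set where
    trivial : ∀ {M} → IsSPM w M → Coherent w M M
    link    : ∀ {M M' N} → IsSPM w M → StrictlyCoherent w M M' → Coherent w M' N → Coherent w M N

  -- a set of quasi special partial matchings of order ideals, given as an
  -- indexed family: M_i has domain dom i and is the map mp i.
  module System (I : Set) (dom : I → A → Set) (mp : I → A → A) where

    IsPirconSystem : Set
    IsPirconSystem =
        IsPircon
      × (∀ i → IsOrderIdeal (dom i) × IsQSPM (dom i) (mp i))
      × (∀ w → ¬ Minimal w → Σ I λ i → dom i w × (mp i w ⋖ w))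
      × (∀ i j w → dom i w → dom j w → mp i w ⋖ w → mp j w ⋖ w → Coherent w (mp i) (mp j))

    Choice : Set
    Choice = (w : A) → ¬ Minimal w → Σ I λ i → dom i w × (mp i w ⋖ w)

    record IsRFamily (x : Xval) (ch : Choice) (R : A → A → Poly) : Set where
      field
        resp  : ∀ u u' w w' → u ≈ u' → w ≈ w' → R u w ≈P R u' w'
        notLe : ∀ u w → ¬ (u ≤ w) → R u w ≈P []
        diag  : ∀ w → R w w ≈P oneP
        down  : ∀ w (nm : ¬ Minimal w) u → u ≤ w →
                  let M = mp (proj₁ (ch w nm)) in
                  M u ⋖ u → R u w ≈P R (M u) (M w)
        up    : ∀ w (nm : ¬ Minimal w) u → u ≤ w →
                  let M = mp (proj₁ (ch w nm)) in
                  u ⋖ M u → R u w ≈P (q-1 *P R u (M w) +P qP *P R (M u) (M w))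
        fixed : ∀ w (nm : ¬ Minimal w) u → u ≤ w →
                  let M = mp (proj₁ (ch w nm)) in
                  M u ≈ u → R u w ≈P (fixFactor x *P R u (M w))

    UpDownSymmetric : Xval → (A → A → Poly) → Set
    UpDownSymmetric x R =
      ∀ i u w → dom i u → dom i w → u ⋖ mp i u →
        let M = mp i in
          (w ⋖ M w → R u w ≈P R (M u) (M w))
        × (M w ⋖ w → R u w ≈P (q-1 *P R (M u) w +P qP *P R (M u) (M w)))
        × (M w ≈ w → R u w ≈P (fixFactor x *P R (M u) w))

-- Coxeter systems.  A Coxeter matrix on a set S: m s t ∈ {1,2,...,∞}
-- (nothing = ∞), m s s = 1, m s t = 1 only if s = t, symmetric.

record IsCoxeterMatrix {S : Set} (m : S → S → Maybe ℕ) : Set where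
  field
    diag  : ∀ s → m s s ≡ just 1
    one⇒≡ : ∀ s t → m s t ≡ just 1 → s ≡ t
    sym   : ∀ s t → m s t ≡ m t s
    nz    : ∀ s t → ¬ (m s t ≡ just 0)

module Coxeter (S : Set) (m : S → S → Maybe ℕ) (H : S → Set) (lem : ExcludedMiddle 0ℓ) where

  -- W = ⟨ S | (st)^{m(s,t)} = e ⟩ : words in S modulo the congruence
  -- generated by the defining relations (elements of S are involutions,
  -- so this monoid presentation is the group presentation).
  Word : Set
  Word = List S

  data _~_ : Word → Word → Set where
    rel    : ∀ (u v : Word) (s t : S) (k : ℕ) → m s t ≡ just k →
               (u ++ (concat (replicate k (s ∷ t ∷ [])) ++ v)) ~ (u ++ v)
    ~refl  : ∀ {u} → u ~ u
    ~sym   : ∀ {u v} → u ~ v → v ~ u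
    ~trans : ∀ {u v w} → u ~ v → v ~ w → u ~ w

  IsLength : Word → ℕ → Set
  IsLength w n = Σ Word λ v → (v ~ w) × (length v ≡ n) × (∀ v' → v' ~ w → n ℕ.≤ length v')

  LenLt : Word → Word → Set
  LenLt u w = Σ ℕ λ a → Σ ℕ λ b → IsLength u a × IsLength w b × (a ℕ.< b)

  IsReflection : Word → Set
  IsReflection t = Σ Word λ v → Σ S λ s → t ~ (v ++ s ∷ reverse v)

  data _≤B_ : Word → Word → Set where
    br-refl : ∀ {u w} → u ~ w → u ≤B w
    br-step : ∀ {u w} (t : Word) → IsReflection t → LenLt u (u ++ t) → (u ++ t) ≤B w → u ≤B w

  InWH : Word → Set
  InWH w = ∀ h → H h → LenLt w (w ++ h ∷ [])

  WH : Set
  WH = Σ Word InWH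

  _≈H_ : WH → WH → Set
  a ≈H b = proj₁ a ~ proj₁ b

  _≤H_ : WH → WH → Set
  a ≤H b = proj₁ a ≤B proj₁ b

  LeftDescent : S → Word → Set
  LeftDescent s w = LenLt (s ∷ w) w

  record IdxH : Set where
    constructor idx
    field
      top  : WH
      gen  : S
      ne   : ¬ (proj₁ top ~ [])
      desc : LeftDescent gen (proj₁ top)

  lamH : S → WH → WH
  lamH s (u , pu) with lem {InWH (s ∷ u)}
  ... | yes p = (s ∷ u , p)
  ... | no _  = (u , pu)

  domH : IdxH → WH → Set
  domH i u = u ≤H IdxH.top i

  mapH : IdxH → WH → WH
  mapH i = lamH (IdxH.gen i)

  open PosetTheory _≈H_ _≤H_ public
  open System IdxH domH mapH public

-- The parity of the number of letters of a word whose associated reflection equals a given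
-- one is invariant under the Coxeter relations. This gives the strong exchange property,
-- hence the lifting properties of the Bruhat order, from which the left multiplication
-- maps on W^H are special partial matchings.
--
-- For generators s, t let x₀ ∈ W^H have minimal length in its coset ⟨s,t⟩ x₀, and let s, t
-- generate a dihedral group of order 2m. The part of the coset inside W^H is everything, a
-- chain with m elements, or x₀ alone, according to how many r ∈ {s,t} satisfy r x₀ ∉ W^H,
-- i.e. r x₀ = x₀ h with h ∈ H. So m(O) is m, m or 1, and it is m for the orbit of w when
-- s, t ∈ D_L(w).
--
-- The recursion R_{·,w} = T_s R_{·,sw} defines operators T_s on functions on W^H satisfying
-- T_s² = (q-1) T_s + q. They satisfy the braid relations: this is clear at the top of each
-- dihedral orbit and passes from s u to u < s u by the quadratic relation. Consequently
-- R_{·,w} = T_s R_{·,sw} for every s ∈ D_L(w), and T_s R_{·,w} = (q-1-x) R_{·,w} when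
-- s w = w h with h ∈ H; evaluating these identities at u and s u gives the symmetry.
module Submission where

open import Defs
open import Level using (0ℓ)
open import Algebra.Bundles using (Group)
import Algebra.Properties.Group as GroupProperties
open import Axiom.ExcludedMiddle using (ExcludedMiddle)
open import Data.Bool as Bool using (Bool; true; false; not; _xor_; if_then_else_)
open import Data.Bool.Properties using (xor-assoc; xor-comm; xor-same; ¬-not; not-involutive)
open import Data.Empty using (⊥; ⊥-elim)
open import Data.Integer as ℤ using (ℤ; +_)
import Data.Integer.Properties as ℤ
open import Data.Integer.Solver using (module +-*-Solver)
open import Data.List using (List; []; _∷_; _++_; length; replicate; concat; reverse; map; [_])
open import Data.List.Membership.Propositional using (_∈_)
open import Data.List.Membership.Propositional.Properties using (∈-map⁺; ∈-++⁺ˡ; ∈-++⁺ʳ)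
open import Data.List.Properties using (++-assoc; ++-identityʳ; unfold-reverse; reverse-++; reverse-involutive; reverse-map; length-++; length-reverse; length-map; map-++)
open import Data.List.Relation.Unary.Any as Any using (Any)
open import Data.Maybe using (Maybe; just)
open import Data.Nat using (ℕ; zero; suc; _+_; _≤_; _<_; z≤n; s≤s)
open import Data.Nat.Divisibility using (_∣_; ∣-refl; 1∣_)
open import Data.Nat.Induction using (<-rec)
open import Data.Nat.Properties
open import Data.Product using (Σ; ∃; ∃₂; _×_; _,_; proj₁; proj₂)
open import Data.Sum using (_⊎_; inj₁; inj₂)
open import Relation.Binary.Definitions using (tri<; tri≈; tri>)
open import Relation.Binary.PropositionalEquality using (_≡_; _≢_; refl; sym; trans; cong; cong₂; subst; subst₂)
import Relation.Binary.Reasoning.Setoid as SetoidReasoning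
open import Relation.Binary.Structures using (IsPartialOrder)
open import Relation.Nullary using (¬_; Dec; yes; no; does)
open import Relation.Nullary.Decidable using (dec-true)

-- The number m is never read off the Coxeter matrix. An element with both left descents s and t
-- forces the two alternating words of some length to be reduced and equal; this is
-- `Longest (suc n)`, and `suc n` serves as m for all cosets at once. The pair s, t is a map
-- `g : Bool → S` which may be constant, so s = t runs through the same argument with m = 1. The
-- family R comes with one chosen descent t for each w, and the obstacle is to compare t with
-- another descent s. As s w and t w are shorter than w, induction unfolds their columns along the
-- two alternating words down to the column of the same coset minimum x₀, and what remains is a
-- braid relation applied to that column. When s w = w h there is no recursion to unfold. That
-- identity is proved by induction on the length of w, inside the coset of s and an arbitrary left
-- descent t of w; it starts at w = e, where the column is supported at e alone.

-- Polynomials are replaced by their coefficient sequences, on which multiplication by q is a shift.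
V : Set
V = ℕ → ℤ

infix 4 _≋_
_≋_ : V → V → Set
a ≋ b = ∀ n → a n ≡ b n

≋-refl : ∀ {a} → a ≋ a
≋-refl n = refl

≋-sym : ∀ {a b} → a ≋ b → b ≋ a
≋-sym p n = sym (p n)

≋-trans : ∀ {a b c} → a ≋ b → b ≋ c → a ≋ c
≋-trans p q n = trans (p n) (q n)

0V : V
0V n = + 0

infixl 6 _⊕_
_⊕_ : V → V → V
(a ⊕ b) n = a n ℤ.+ b n

q· : V → V
q· a zero    = + 0
q· a (suc n) = a n

q-1· : V → V
q-1· a n = q· a n ℤ.- a n

-- Multiplication by q - 1 - x, which is -1 for x = q and q for x = -1.
c· : Xval → V → V
c· x=q  a n = ℤ.- a n
c· x=-1 a   = q· a

⊕-cong : ∀ {a a′ b b′} → a ≋ a′ → b ≋ b′ → a ⊕ b ≋ a′ ⊕ b′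
⊕-cong p q n = cong₂ ℤ._+_ (p n) (q n)

q·-cong : ∀ {a b} → a ≋ b → q· a ≋ q· b
q·-cong p zero    = refl
q·-cong p (suc n) = p n

q-1·-cong : ∀ {a b} → a ≋ b → q-1· a ≋ q-1· b
q-1·-cong p n = cong₂ ℤ._-_ (q·-cong p n) (p n)

c·-cong : ∀ x {a b} → a ≋ b → c· x a ≋ c· x b
c·-cong x=q  p n = cong ℤ.-_ (p n)
c·-cong x=-1 p   = q·-cong p

-- The R-recursion at an ascent.
mix : V → V → V
mix a b = q-1· a ⊕ q· b

mix-cong : ∀ {a a′ b b′} → a ≋ a′ → b ≋ b′ → mix a b ≋ mix a′ b′
mix-cong p q = ⊕-cong (q-1·-cong p) (q·-cong q)

mix-0 : mix 0V 0V ≋ 0V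
mix-0 zero    = refl
mix-0 (suc n) = refl

c·-0 : ∀ x → c· x 0V ≋ 0V
c·-0 x=q  n       = refl
c·-0 x=-1 zero    = refl
c·-0 x=-1 (suc n) = refl

q·-mix : ∀ a b → q· (mix a b) ≋ mix (q· a) (q· b)
q·-mix a b zero    = refl
q·-mix a b (suc n) = refl

open +-*-Solver using (solve; _:=_; _:+_; _:-_; :-_; _:*_; con)

c·-mix : ∀ x a b → c· x (mix a b) ≋ mix (c· x a) (c· x b)
c·-mix x=q a b zero = solve 1 (λ a → :- ((con (+ 0) :- a) :+ con (+ 0)) := (con (+ 0) :- (:- a)) :+ con (+ 0)) refl (a 0)
c·-mix x=q a b (suc n) =
  solve 3 (λ a a′ b → :- ((a :- a′) :+ b) := ((:- a) :- (:- a′)) :+ (:- b)) refl (a n) (a (suc n)) (b n)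
c·-mix x=-1 a b = q·-mix a b

-- Multiplications by q - 1 and by q commute; this is what linearity of T_s amounts to at an ascent.
mix-mix : ∀ a b c d → mix (mix a b) (mix c d) ≋ mix (mix a c) (mix b d)
mix-mix a b c d zero = refl
mix-mix a b c d (suc n) =
  solve 8 (λ qa a a′ qb b qc c qd → (((qa :- a) :+ qb) :- ((a :- a′) :+ b)) :+ ((qc :- c) :+ qd)
                                 := (((qa :- a) :+ qc) :- ((a :- a′) :+ c)) :+ ((qb :- b) :+ qd)) refl
    (q· a n) (a n) (a (suc n)) (q· b n) (b n) (q· c n) (c n) (q· d n)

-- The two admissible values of c = q - 1 - x are the roots of c² = (q - 1) c + q.
c·-quadratic : ∀ x a → c· x (c· x a) ≋ mix (c· x a) a
c·-quadratic x=q a zero    = solve 1 (λ a → :- (:- a) := (con (+ 0) :- (:- a)) :+ con (+ 0)) refl (a 0)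
c·-quadratic x=q a (suc n) = solve 2 (λ a a′ → :- (:- a′) := ((:- a) :- (:- a′)) :+ a) refl (a n) (a (suc n))
c·-quadratic x=-1 a n      = solve 2 (λ p r → p := (p :- r) :+ r) refl (q· (q· a) n) (q· a n)

-- From coefficient lists to coefficient sequences

coeff-+P : ∀ p r → coeff (p +P r) ≋ coeff p ⊕ coeff r
coeff-+P []      r       n       = sym (ℤ.+-identityˡ _)
coeff-+P (a ∷ p) []      n       = sym (ℤ.+-identityʳ _)
coeff-+P (a ∷ p) (b ∷ r) zero    = refl
coeff-+P (a ∷ p) (b ∷ r) (suc n) = coeff-+P p r n

coeff-scale : ∀ a r n → coeff (map (a ℤ.*_) r) n ≡ a ℤ.* coeff r n
coeff-scale a []      n       = sym (ℤ.*-zeroʳ a)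
coeff-scale a (b ∷ r) zero    = refl
coeff-scale a (b ∷ r) (suc n) = coeff-scale a r n

coeff-shift : ∀ r → coeff (+ 0 ∷ r) ≋ q· (coeff r)
coeff-shift r zero    = refl
coeff-shift r (suc n) = refl

-- The factors q, q - 1 and q - 1 - x all reduce to lists of exactly two coefficients (the second
-- one is 0 in q - 1 - x for x = q), so one computation serves them all.
coeff-linear-*P : ∀ a b r n → coeff ((a ∷ b ∷ []) *P r) n ≡ a ℤ.* coeff r n ℤ.+ b ℤ.* q· (coeff r) n
coeff-linear-*P a b r n =
  trans (coeff-+P (map (a ℤ.*_) r) _ n)
    (cong₂ ℤ._+_ (coeff-scale a r n) (shifted n))
  where
  inner : ∀ n → coeff (map (b ℤ.*_) r +P (+ 0 ∷ [])) n ≡ b ℤ.* coeff r n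
  inner n = trans (coeff-+P (map (b ℤ.*_) r) (+ 0 ∷ []) n)
    (trans (cong₂ ℤ._+_ (coeff-scale b r n) (coeff-shift [] n)) (trans (cong (λ z → b ℤ.* coeff r n ℤ.+ z) (q·0 n)) (ℤ.+-identityʳ _)))
    where
    q·0 : ∀ n → q· (coeff []) n ≡ + 0
    q·0 zero    = refl
    q·0 (suc n) = refl
  shifted : ∀ n → coeff (+ 0 ∷ (map (b ℤ.*_) r +P (+ 0 ∷ []))) n ≡ b ℤ.* q· (coeff r) n
  shifted zero    = sym (ℤ.*-zeroʳ b)
  shifted (suc n) = inner n

coeff-qP : ∀ r → coeff (qP *P r) ≋ q· (coeff r)
coeff-qP r n = trans (coeff-linear-*P (+ 0) (+ 1) r n)
  (solve 2 (λ a b → con (+ 0) :* a :+ con (+ 1) :* b := b) refl (coeff r n) (q· (coeff r) n))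

coeff-q-1 : ∀ r → coeff (q-1 *P r) ≋ q-1· (coeff r)
coeff-q-1 r n = trans (coeff-linear-*P (ℤ.- + 1) (+ 1) r n)
  (solve 2 (λ a b → con (ℤ.- + 1) :* a :+ con (+ 1) :* b := b :- a) refl (coeff r n) (q· (coeff r) n))

coeff-fixFactor : ∀ x r → coeff (fixFactor x *P r) ≋ c· x (coeff r)
coeff-fixFactor x=q r n = trans (coeff-linear-*P (ℤ.- + 1) (+ 0) r n)
  (solve 2 (λ a b → con (ℤ.- + 1) :* a :+ con (+ 0) :* b := :- a) refl (coeff r n) (q· (coeff r) n))
coeff-fixFactor x=-1 r n = trans (coeff-linear-*P (+ 0) (+ 1) r n)
  (solve 2 (λ a b → con (+ 0) :* a :+ con (+ 1) :* b := b) refl (coeff r n) (q· (coeff r) n))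

coeff-mix : ∀ r r′ → coeff (q-1 *P r +P qP *P r′) ≋ mix (coeff r) (coeff r′)
coeff-mix r r′ = ≋-trans (coeff-+P (q-1 *P r) (qP *P r′)) (⊕-cong (coeff-q-1 r) (coeff-qP r′))

-- The form taken by the conclusion of the exchange condition. Matching on `del` or `keep` tells
-- whether the leading letter was removed, on which several arguments turn.
data Del {A : Set} : List A → List A → Set where
  del  : ∀ {x xs} → Del (x ∷ xs) xs
  keep : ∀ {x xs ys} → Del xs ys → Del (x ∷ xs) (x ∷ ys)

Del-length : ∀ {A : Set} {xs ys : List A} → Del xs ys → length xs ≡ suc (length ys)
Del-length del      = refl
Del-length (keep d) = cong suc (Del-length d)

Del-++ : ∀ {A : Set} (xs {ys} {zs} : List A) → Del (xs ++ ys) zs →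
  (∃ λ xs′ → Del xs xs′ × zs ≡ xs′ ++ ys) ⊎ (∃ λ ys′ → Del ys ys′ × zs ≡ xs ++ ys′)
Del-++ []       d   = inj₂ (_ , d , refl)
Del-++ (x ∷ xs) del = inj₁ (xs , del , refl)
Del-++ (x ∷ xs) (keep d) with Del-++ xs d
... | inj₁ (xs′ , e , refl) = inj₁ (x ∷ xs′ , keep e , refl)
... | inj₂ (ys′ , e , refl) = inj₂ (ys′ , e , refl)

Del-map : ∀ {A B : Set} (f : A → B) (xs : List A) {ys} → Del (map f xs) ys →
  ∃ λ xs′ → Del xs xs′ × ys ≡ map f xs′
Del-map f (x ∷ xs) del = xs , del , refl
Del-map f (x ∷ xs) (keep d) with Del-map f xs d
... | xs′ , e , refl = x ∷ xs′ , keep e , refl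

-- The Coxeter group: inverses, reflections, length, exchange

module CoxeterGroup (lem : ExcludedMiddle 0ℓ) (S : Set) (m : S → S → Maybe ℕ)
                    (cox : IsCoxeterMatrix m) (H : S → Set) where

  open Coxeter S m H lem using (Word; _~_; rel; ~refl; ~sym; ~trans; IsLength; LenLt; IsReflection)

  private
    block : S → S → ℕ → Word
    block s t k = concat (replicate k (s ∷ t ∷ []))

  ++-congˡ : ∀ c {a b} → a ~ b → (c ++ a) ~ (c ++ b)
  ++-congˡ c (rel u v s t k e) =
    subst₂ _~_ (++-assoc c u (block s t k ++ v)) (++-assoc c u v) (rel (c ++ u) v s t k e)
  ++-congˡ c ~refl        = ~refl
  ++-congˡ c (~sym p)     = ~sym (++-congˡ c p)
  ++-congˡ c (~trans p q) = ~trans (++-congˡ c p) (++-congˡ c q)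

  ++-congʳ : ∀ c {a b} → a ~ b → (a ++ c) ~ (b ++ c)
  ++-congʳ c (rel u v s t k e) = subst₂ _~_
    (trans (cong (u ++_) (sym (++-assoc (block s t k) v c))) (sym (++-assoc u (block s t k ++ v) c)))
    (sym (++-assoc u v c)) (rel u (v ++ c) s t k e)
  ++-congʳ c ~refl        = ~refl
  ++-congʳ c (~sym p)     = ~sym (++-congʳ c p)
  ++-congʳ c (~trans p q) = ~trans (++-congʳ c p) (++-congʳ c q)

  ∷-cong : ∀ s {a b} → a ~ b → (s ∷ a) ~ (s ∷ b)
  ∷-cong s = ++-congˡ [ s ]

  cancel : ∀ s w → (s ∷ s ∷ w) ~ w
  cancel s w = rel [] w s s 1 (IsCoxeterMatrix.diag cox s)

  ≡⇒~ : ∀ {a b} → a ≡ b → a ~ b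
  ≡⇒~ refl = ~refl

  inverseˡ : ∀ w → (reverse w ++ w) ~ []
  inverseˡ []      = ~refl
  inverseˡ (s ∷ w) = ~trans
    (≡⇒~ (trans (cong (_++ s ∷ w) (unfold-reverse s w)) (++-assoc (reverse w) [ s ] (s ∷ w))))
    (~trans (++-congˡ (reverse w) (cancel s w)) (inverseˡ w))

  inverseʳ : ∀ w → (w ++ reverse w) ~ []
  inverseʳ w = subst (λ v → (v ++ reverse w) ~ []) (reverse-involutive w) (inverseˡ (reverse w))

  -- Uniqueness of inverses: a⁻¹ = a⁻¹ b b⁻¹ = a⁻¹ a b⁻¹ = b⁻¹.
  reverse-cong : ∀ {a b} → a ~ b → reverse a ~ reverse b
  reverse-cong {a} {b} p =
    ~trans (≡⇒~ (sym (++-identityʳ (reverse a))))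
    (~trans (++-congˡ (reverse a) (~sym (inverseʳ b)))
    (~trans (++-congˡ (reverse a) (++-congʳ (reverse b) (~sym p)))
    (~trans (≡⇒~ (sym (++-assoc (reverse a) a (reverse b))))
    (++-congʳ (reverse b) (inverseˡ a)))))

  W : Group 0ℓ 0ℓ
  W = record
    { Carrier = Word ; _≈_ = _~_ ; _∙_ = _++_ ; ε = [] ; _⁻¹ = reverse
    ; isGroup = record
      { isMonoid = record
        { isSemigroup = record
          { isMagma = record
            { isEquivalence = record { refl = ~refl ; sym = ~sym ; trans = ~trans }
            ; ∙-cong = λ {a} {b} {c} {d} p q → ~trans (++-congʳ c p) (++-congˡ b q) }
          ; assoc = λ a b c → ≡⇒~ (++-assoc a b c) }
        ; identity = (λ _ → ~refl) , (λ a → ≡⇒~ (++-identityʳ a)) }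
      ; inverse = inverseˡ , inverseʳ
      ; ⁻¹-cong = reverse-cong } }

  open GroupProperties W using () renaming (∙-cancelˡ to ++-cancelˡ; ∙-cancelʳ to ++-cancelʳ) public
  open SetoidReasoning (Group.setoid W)

  inverseˡ-++ : ∀ w v → (reverse w ++ (w ++ v)) ~ v
  inverseˡ-++ w v = ~trans (≡⇒~ (sym (++-assoc (reverse w) w v))) (++-congʳ v (inverseˡ w))

  inverseʳ-++ : ∀ w v → (w ++ (reverse w ++ v)) ~ v
  inverseʳ-++ w v = ~trans (≡⇒~ (sym (++-assoc w (reverse w) v))) (++-congʳ v (inverseʳ w))

  -- Parity of the reflections attached to a word

  module ReflectionCount where

    ind : Word → Word → Bool
    ind r t = does (lem {r ~ t})

    ind-cong : ∀ {r t r′ t′} → (r ~ t → r′ ~ t′) → (r′ ~ t′ → r ~ t) → ind r t ≡ ind r′ t′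
    ind-cong {r} {t} {r′} {t′} f g with lem {r ~ t} | lem {r′ ~ t′}
    ... | yes _ | yes _ = refl
    ... | yes p | no ¬q = ⊥-elim (¬q (f p))
    ... | no ¬p | yes q = ⊥-elim (¬p (g q))
    ... | no _  | no _  = refl

    -- Parity of the number of letters of the word whose associated right
    -- reflection is t.
    N : Word → Word → Bool
    N []      t = false
    N (s ∷ w) t = ind (reverse w ++ s ∷ w) t xor N w t

    N-congʳ : ∀ w {t t′} → t ~ t′ → N w t ≡ N w t′
    N-congʳ []      p = refl
    N-congʳ (s ∷ w) p =
      cong₂ _xor_ (ind-cong (λ q → ~trans q p) (λ q → ~trans q (~sym p))) (N-congʳ w p)

    conj : Word → Word → Word
    conj v t = v ++ (t ++ reverse v)

    conj-cong : ∀ {v v′ t} → v ~ v′ → conj v t ~ conj v′ t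
    conj-cong {v} {v′} {t} p = begin
      v ++ (t ++ reverse v)    ≈⟨ ++-congʳ _ p ⟩
      v′ ++ (t ++ reverse v)   ≈⟨ ++-congˡ v′ (++-congˡ t (reverse-cong p)) ⟩
      v′ ++ (t ++ reverse v′)  ∎

    -- A letter of u with reflection r inside u has reflection v⁻¹ r v inside u v, and this equals t
    -- exactly when r = v t v⁻¹.
    N-++ : ∀ u v t → N (u ++ v) t ≡ N u (conj v t) xor N v t
    N-++ []      v t = refl
    N-++ (s ∷ u) v t = trans (cong₂ _xor_ (ind-cong to from) (N-++ u v t))
                             (sym (xor-assoc (ind (reverse u ++ s ∷ u) (conj v t)) (N u (conj v t)) (N v t)))
      where
      shape : (reverse (u ++ v) ++ s ∷ (u ++ v)) ≡ reverse v ++ ((reverse u ++ s ∷ u) ++ v)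
      shape = trans (cong (_++ s ∷ (u ++ v)) (reverse-++ u v))
             (trans (++-assoc (reverse v) (reverse u) _)
                    (cong (reverse v ++_) (sym (++-assoc (reverse u) (s ∷ u) v))))
      to : (reverse (u ++ v) ++ s ∷ (u ++ v)) ~ t → (reverse u ++ s ∷ u) ~ conj v t
      to p = begin
        reverse u ++ s ∷ u
          ≈⟨ ≡⇒~ (sym (++-identityʳ _)) ⟩
        (reverse u ++ s ∷ u) ++ []
          ≈⟨ ++-congˡ (reverse u ++ s ∷ u) (inverseʳ v) ⟨
        (reverse u ++ s ∷ u) ++ (v ++ reverse v)
          ≈⟨ inverseʳ-++ v _ ⟨
        v ++ (reverse v ++ ((reverse u ++ s ∷ u) ++ (v ++ reverse v)))
          ≡⟨ cong (v ++_) (trans (cong (reverse v ++_) (sym (++-assoc _ v (reverse v)))) (sym (++-assoc (reverse v) _ (reverse v)))) ⟩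
        v ++ ((reverse v ++ ((reverse u ++ s ∷ u) ++ v)) ++ reverse v)
          ≈⟨ ++-congˡ v (++-congʳ (reverse v) (~trans (≡⇒~ (sym shape)) p)) ⟩
        v ++ (t ++ reverse v) ∎
      from : (reverse u ++ s ∷ u) ~ conj v t → (reverse (u ++ v) ++ s ∷ (u ++ v)) ~ t
      from p = begin
        reverse (u ++ v) ++ s ∷ (u ++ v)           ≡⟨ shape ⟩
        reverse v ++ ((reverse u ++ s ∷ u) ++ v)   ≈⟨ ++-congˡ (reverse v) (++-congʳ v p) ⟩
        reverse v ++ ((v ++ (t ++ reverse v)) ++ v) ≡⟨ cong (reverse v ++_) (++-assoc v _ v) ⟩
        reverse v ++ (v ++ ((t ++ reverse v) ++ v)) ≈⟨ inverseˡ-++ v _ ⟩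
        (t ++ reverse v) ++ v                      ≡⟨ ++-assoc t _ v ⟩
        t ++ (reverse v ++ v)                      ≈⟨ ++-congˡ t (inverseˡ v) ⟩
        t ++ []                                    ≡⟨ ++-identityʳ t ⟩
        t ∎

    module _ (s t : S) where

      private
        P : ℕ → Word
        P = block s t

      P-shift : ∀ k y → P k ++ s ∷ t ∷ y ≡ s ∷ t ∷ (P k ++ y)
      P-shift zero    y = refl
      P-shift (suc k) y = cong (λ z → s ∷ t ∷ z) (P-shift k y)

      P-+ : ∀ k n → P (k + n) ≡ P k ++ P n
      P-+ zero    n = refl
      P-+ (suc k) n = cong (λ z → s ∷ t ∷ z) (P-+ k n)

      -- Conjugation by t inverts s t; the trailing y makes the identity usable inside longer words.
      P-flip : ∀ k y → (P k ++ t ∷ (P k ++ y)) ~ (t ∷ y)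
      P-flip zero    y = ~refl
      P-flip (suc k) y = begin
        s ∷ t ∷ (P k ++ t ∷ s ∷ t ∷ (P k ++ y))
          ≡⟨ cong (λ z → s ∷ t ∷ (P k ++ t ∷ z)) (P-shift k y) ⟨
        s ∷ t ∷ (P k ++ t ∷ (P k ++ s ∷ t ∷ y))
          ≈⟨ ∷-cong s (∷-cong t (P-flip k _)) ⟩
        s ∷ t ∷ t ∷ s ∷ t ∷ y
          ≈⟨ ∷-cong s (cancel t _) ⟩
        s ∷ s ∷ t ∷ y
          ≈⟨ cancel s _ ⟩
        t ∷ y ∎

      P-conj : ∀ k y → (reverse (P k) ++ t ∷ (P k ++ y)) ~ (t ∷ (P (k + k) ++ y))
      P-conj k y = begin
        reverse (P k) ++ t ∷ (P k ++ y)
          ≈⟨ ++-congˡ (reverse (P k)) (P-flip k (P k ++ y)) ⟨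
        reverse (P k) ++ (P k ++ t ∷ (P k ++ (P k ++ y)))
          ≈⟨ inverseˡ-++ (P k) _ ⟩
        t ∷ (P k ++ (P k ++ y))
          ≡⟨ cong (t ∷_) (trans (sym (++-assoc (P k) (P k) y)) (cong (_++ y) (sym (P-+ k k)))) ⟩
        t ∷ (P (k + k) ++ y) ∎

      -- Parity of the number of i < n with t (st)^i = r.
      F : Word → ℕ → Bool
      F r zero    = false
      F r (suc n) = ind (t ∷ P n) r xor F r n

      -- By `P-conj` the two letters in front of (st)^k contribute the reflections t (st)^(2k) and t
      -- (st)^(2k+1), so the letters of (st)^k give t (st)^i for all i < 2k.
      N-block : ∀ r k → N (P k) r ≡ F r (k + k)
      N-block r zero    = refl
      N-block r (suc k) rewrite +-suc k k =
        cong₂ _xor_ (ind-cong (~trans (~sym eq₂)) (~trans eq₂))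
          (cong₂ _xor_ (ind-cong (~trans (~sym eq₁)) (~trans eq₁)) (N-block r k))
        where
        eq₁ : (reverse (P k) ++ t ∷ P k) ~ (t ∷ P (k + k))
        eq₁ = subst₂ (λ a b → (reverse (P k) ++ t ∷ a) ~ (t ∷ b)) (++-identityʳ _) (++-identityʳ _) (P-conj k [])
        eq₂ : (reverse (t ∷ P k) ++ s ∷ t ∷ P k) ~ (t ∷ s ∷ t ∷ P (k + k))
        eq₂ = begin
          reverse (t ∷ P k) ++ s ∷ t ∷ P k         ≡⟨ cong (_++ s ∷ t ∷ P k) (unfold-reverse t (P k)) ⟩
          (reverse (P k) ++ [ t ]) ++ s ∷ t ∷ P k  ≡⟨ ++-assoc (reverse (P k)) [ t ] _ ⟩
          reverse (P k) ++ t ∷ s ∷ t ∷ P k         ≡⟨ cong (λ z → reverse (P k) ++ t ∷ s ∷ t ∷ z) (++-identityʳ (P k)) ⟨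
          reverse (P k) ++ t ∷ s ∷ t ∷ (P k ++ []) ≡⟨ cong (λ z → reverse (P k) ++ t ∷ z) (P-shift k []) ⟨
          reverse (P k) ++ t ∷ (P k ++ s ∷ t ∷ []) ≈⟨ P-conj k _ ⟩
          t ∷ (P (k + k) ++ s ∷ t ∷ [])            ≡⟨ cong (t ∷_) (P-shift (k + k) []) ⟩
          t ∷ s ∷ t ∷ (P (k + k) ++ [])            ≡⟨ cong (λ z → t ∷ s ∷ t ∷ z) (++-identityʳ _) ⟩
          t ∷ s ∷ t ∷ P (k + k) ∎

      F-periodic : ∀ r k n → P k ~ [] → F r (n + k) ≡ F r n xor F r k
      F-periodic r k zero    p = refl
      F-periodic r k (suc n) p = trans
        (cong₂ _xor_ (ind-cong (~trans (~sym eq)) (~trans eq)) (F-periodic r k n p))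
        (sym (xor-assoc (ind (t ∷ P n) r) (F r n) (F r k)))
        where
        eq : (t ∷ P (n + k)) ~ (t ∷ P n)
        eq = ∷-cong t (~trans (≡⇒~ (P-+ n k)) (~trans (++-congˡ (P n) p) (≡⇒~ (++-identityʳ _))))

      block~[] : ∀ k → m s t ≡ just k → P k ~ []
      block~[] k e = ~trans (≡⇒~ (sym (++-identityʳ _))) (rel [] [] s t k e)

      -- When (st)^k = e the sequence t (st)^i has period k, so its first 2k terms meet every
      -- reflection an even number of times.
      N-relator : ∀ r k → m s t ≡ just k → N (P k) r ≡ false
      N-relator r k e = trans (N-block r k) (trans (F-periodic r k k (block~[] k e)) (xor-same (F r k)))

    N-congˡ : ∀ {u v} t → u ~ v → N u t ≡ N v t
    N-congˡ t (rel u v a b k e) =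
      trans (N-++ u (block a b k ++ v) t)
     (trans (cong₂ _xor_ (N-congʳ u (conj-cong (++-congʳ v (block~[] a b k e))))
              (trans (N-++ (block a b k) v t) (cong (_xor N v t) (N-relator a b (conj v t) k e))))
            (sym (N-++ u v t)))
    N-congˡ t ~refl        = refl
    N-congˡ t (~sym p)     = sym (N-congˡ t p)
    N-congˡ t (~trans p q) = trans (N-congˡ t p) (N-congˡ t q)

    -- An odd count means that some letter has reflection t. Writing w = a s b with t = b⁻¹ s b
    -- gives w t = a b.
    N⇒Del : ∀ w t → N w t ≡ true → ∃ λ w′ → Del w w′ × (w ++ t) ~ w′
    N⇒Del (s ∷ w) t e with lem {(reverse w ++ s ∷ w) ~ t}
    ... | yes p = w , del , (begin
            s ∷ (w ++ t)                      ≈⟨ ∷-cong s (++-congˡ w p) ⟨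
            s ∷ (w ++ (reverse w ++ s ∷ w))   ≈⟨ ∷-cong s (inverseʳ-++ w _) ⟩
            s ∷ s ∷ w                         ≈⟨ cancel s w ⟩
            w ∎)
    ... | no _ with N⇒Del w t e
    ...   | w′ , d , p = s ∷ w′ , keep d , ∷-cong s p

    -- The letters of v and of v⁻¹ together count as in v v⁻¹ = e, hence evenly; the middle letter
    -- has the whole word as its reflection.
    N-self : ∀ v s → N (v ++ s ∷ reverse v) (v ++ s ∷ reverse v) ≡ true
    N-self v s = trans (N-++ v (s ∷ reverse v) r) (go (N v s′) (N (reverse v) r) e₁ e₂)
      where
      r = v ++ s ∷ reverse v
      s′ = conj (s ∷ reverse v) r
      rv : conj (reverse v) r ~ [ s ]
      rv = begin
        reverse v ++ ((v ++ s ∷ reverse v) ++ reverse (reverse v)) ≡⟨ cong (λ z → reverse v ++ (r ++ z)) (reverse-involutive v) ⟩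
        reverse v ++ ((v ++ s ∷ reverse v) ++ v)                   ≡⟨ cong (reverse v ++_) (++-assoc v _ v) ⟩
        reverse v ++ (v ++ (s ∷ (reverse v ++ v)))                 ≈⟨ inverseˡ-++ v _ ⟩
        s ∷ (reverse v ++ v)                                       ≈⟨ ∷-cong s (inverseˡ v) ⟩
        [ s ] ∎
      srv : s′ ~ [ s ]
      srv = begin
        s ∷ (reverse v ++ (r ++ reverse (s ∷ reverse v)))         ≡⟨ cong (λ z → s ∷ (reverse v ++ (r ++ z))) (unfold-reverse s (reverse v)) ⟩
        s ∷ (reverse v ++ (r ++ (reverse (reverse v) ++ [ s ])))  ≡⟨ cong (λ z → s ∷ (reverse v ++ z)) (sym (++-assoc r _ [ s ])) ⟩
        s ∷ (reverse v ++ ((r ++ reverse (reverse v)) ++ [ s ]))  ≡⟨ cong (s ∷_) (sym (++-assoc (reverse v) _ [ s ])) ⟩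
        s ∷ (conj (reverse v) r ++ [ s ])                         ≈⟨ ∷-cong s (++-congʳ [ s ] rv) ⟩
        s ∷ s ∷ s ∷ []                                            ≈⟨ cancel s _ ⟩
        [ s ] ∎
      e₁ : N v s′ xor N (reverse v) r ≡ false
      e₁ = trans (cong (_xor N (reverse v) r) (N-congʳ v (~trans srv (~sym rv))))
                 (trans (sym (N-++ v (reverse v) r)) (N-congˡ r (inverseʳ v)))
      e₂ : ind (reverse (reverse v) ++ s ∷ reverse v) r ≡ true
      e₂ = dec-true lem (≡⇒~ (cong (_++ s ∷ reverse v) (reverse-involutive v)))
      go : ∀ a b {c} → a xor b ≡ false → c ≡ true → a xor (c xor b) ≡ true
      go false false _ refl = refl
      go true  true  _ refl = refl

  open ReflectionCount using (N; N-congˡ; N-congʳ; N-++; N⇒Del; N-self)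

  -- The length function

  abstract
    -- Opaque, so that `ℓ` never unfolds into the well-founded search during type checking.
    hasLength : ∀ w → ∃ (IsLength w)
    hasLength w = <-rec (λ n → ∀ v → v ~ w → length v ≡ n → ∃ (IsLength w)) search (length w) w ~refl refl
      where
      search : ∀ n → (∀ {k} → k < n → ∀ v → v ~ w → length v ≡ k → ∃ (IsLength w)) →
               ∀ v → v ~ w → length v ≡ n → ∃ (IsLength w)
      search n shorter v p e with lem {∃ λ v′ → v′ ~ w × length v′ < n}
      ... | yes (v′ , q , lt) = shorter lt v′ q refl
      ... | no  ¬shorter      = n , v , p , e , λ v′ q → ≮⇒≥ λ lt → ¬shorter (v′ , q , lt)

  ℓ : Word → ℕ
  ℓ w = proj₁ (hasLength w)

  IsLength-unique : ∀ {w a b} → IsLength w a → IsLength w b → a ≡ b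
  IsLength-unique (v , p , refl , f) (v′ , p′ , refl , f′) = ≤-antisym (f v′ p′) (f′ v p)

  LenLt⇒< : ∀ {u w} → LenLt u w → ℓ u < ℓ w
  LenLt⇒< {u} {w} (a , b , p , q , lt) =
    subst₂ _<_ (IsLength-unique p (proj₂ (hasLength u))) (IsLength-unique q (proj₂ (hasLength w))) lt

  <⇒LenLt : ∀ {u w} → ℓ u < ℓ w → LenLt u w
  <⇒LenLt {u} {w} lt = ℓ u , ℓ w , proj₂ (hasLength u) , proj₂ (hasLength w) , lt

  ℓ≤length : ∀ {v w} → v ~ w → ℓ w ≤ length v
  ℓ≤length {v} {w} p = proj₂ (proj₂ (proj₂ (proj₂ (hasLength w)))) v p

  reducedWord : ∀ w → ∃ λ v → v ~ w × length v ≡ ℓ w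
  reducedWord w = let (v , p , e , _) = proj₂ (hasLength w) in v , p , e

  ℓ-≤-cong : ∀ {u v} → u ~ v → ℓ v ≤ ℓ u
  ℓ-≤-cong {u} p with reducedWord u
  ... | u′ , q , e = subst (_ ≤_) e (ℓ≤length (~trans q p))

  ℓ-cong : ∀ {u v} → u ~ v → ℓ u ≡ ℓ v
  ℓ-cong p = ≤-antisym (ℓ-≤-cong (~sym p)) (ℓ-≤-cong p)

  ℓ[]≡0 : ℓ [] ≡ 0
  ℓ[]≡0 = n≤0⇒n≡0 (ℓ≤length ~refl)

  ℓ-++ : ∀ u v → ℓ (u ++ v) ≤ ℓ u + ℓ v
  ℓ-++ u v with reducedWord u | reducedWord v
  ... | u′ , p , e | v′ , q , f =
    subst (ℓ (u ++ v) ≤_) (trans (length-++ u′) (cong₂ _+_ e f))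
      (ℓ≤length (~trans (++-congʳ v′ p) (++-congˡ u q)))

  ℓ-++-≤ : ∀ v u → ℓ (v ++ u) ≤ length v + ℓ u
  ℓ-++-≤ v u = ≤-trans (ℓ-++ v u) (+-monoˡ-≤ (ℓ u) (ℓ≤length ~refl))

  ℓ-reverse-≤ : ∀ u → ℓ (reverse u) ≤ ℓ u
  ℓ-reverse-≤ u with reducedWord u
  ... | u′ , p , e = subst (ℓ (reverse u) ≤_) (trans (length-reverse u′) e) (ℓ≤length (reverse-cong p))

  ℓ-reverse : ∀ u → ℓ (reverse u) ≡ ℓ u
  ℓ-reverse u = ≤-antisym (ℓ-reverse-≤ u)
    (subst (λ z → ℓ z ≤ ℓ (reverse u)) (reverse-involutive u) (ℓ-reverse-≤ (reverse u)))

  parity : ℕ → Bool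
  parity zero    = false
  parity (suc n) = not (parity n)

  parity-+ : ∀ a b → parity (a + b) ≡ parity a xor parity b
  parity-+ zero    b = refl
  parity-+ (suc a) b rewrite parity-+ a b with parity a
  ... | true  = not-involutive (parity b)
  ... | false = refl

  block-even : ∀ s t k → parity (length (block s t k)) ≡ false
  block-even s t zero    = refl
  block-even s t (suc k) = trans (not-involutive _) (block-even s t k)

  parity-cong : ∀ {u v} → u ~ v → parity (length u) ≡ parity (length v)
  parity-cong (rel u v s t k e)
    rewrite length-++ u {block s t k ++ v} | length-++ (block s t k) {v} | length-++ u {v}
          | parity-+ (length u) (length (block s t k) + length v) | parity-+ (length (block s t k)) (length v)
          | parity-+ (length u) (length v) | block-even s t k = refl
  parity-cong ~refl        = refl
  parity-cong (~sym p)     = sym (parity-cong p)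
  parity-cong (~trans p q) = trans (parity-cong p) (parity-cong q)

  parity-ℓ : ∀ w → parity (ℓ w) ≡ parity (length w)
  parity-ℓ w with reducedWord w
  ... | v , p , e = trans (cong parity (sym e)) (parity-cong p)

  -- Relators have even length, so the parity of the length of a word is an invariant of the group
  -- element.
  ℓ-∷-≢ : ∀ s w → ℓ (s ∷ w) ≢ ℓ w
  ℓ-∷-≢ s w e = not-fix _ (trans (sym (parity-ℓ (s ∷ w))) (trans (cong parity e) (parity-ℓ w)))
    where
    not-fix : ∀ b → not b ≢ b
    not-fix true  ()
    not-fix false ()

  ℓ-∷-≤ : ∀ s w → ℓ (s ∷ w) ≤ suc (ℓ w)
  ℓ-∷-≤ s w = ℓ-++-≤ [ s ] w

  ℓ-∷-≥ : ∀ s w → ℓ w ≤ suc (ℓ (s ∷ w))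
  ℓ-∷-≥ s w = subst (_≤ suc (ℓ (s ∷ w))) (ℓ-cong (cancel s w)) (ℓ-∷-≤ s (s ∷ w))

  ascent⇒suc : ∀ {s w} → ℓ w < ℓ (s ∷ w) → ℓ (s ∷ w) ≡ suc (ℓ w)
  ascent⇒suc {s} {w} lt = ≤-antisym (ℓ-∷-≤ s w) lt

  descent⇒suc : ∀ {s w} → ℓ (s ∷ w) < ℓ w → ℓ w ≡ suc (ℓ (s ∷ w))
  descent⇒suc {s} {w} lt = ≤-antisym (ℓ-∷-≥ s w) lt

  ascent-or-descent : ∀ s w → ℓ w < ℓ (s ∷ w) ⊎ ℓ (s ∷ w) < ℓ w
  ascent-or-descent s w with <-cmp (ℓ w) (ℓ (s ∷ w))
  ... | tri< lt _ _ = inj₁ lt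
  ... | tri≈ _ eq _ = ⊥-elim (ℓ-∷-≢ s w (sym eq))
  ... | tri> _ _ gt = inj₂ gt

  -- Reflections and the strong exchange property

  reflection-involutive : ∀ {t} → IsReflection t → (t ++ t) ~ []
  reflection-involutive {t} (v , s , p) = begin
    t ++ t                          ≈⟨ ~trans (++-congʳ t p) (++-congˡ _ p) ⟩
    (v ++ s ∷ reverse v) ++ (v ++ s ∷ reverse v)   ≡⟨ ++-assoc v _ _ ⟩
    v ++ s ∷ (reverse v ++ (v ++ s ∷ reverse v))   ≈⟨ ++-congˡ v (∷-cong s (inverseˡ-++ v _)) ⟩
    v ++ s ∷ s ∷ reverse v          ≈⟨ ++-congˡ v (cancel s _) ⟩
    v ++ reverse v                  ≈⟨ inverseʳ v ⟩
    [] ∎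

  ++-reflection² : ∀ w {t} → IsReflection t → ((w ++ t) ++ t) ~ w
  ++-reflection² w {t} r = begin
    (w ++ t) ++ t  ≡⟨ ++-assoc w t t ⟩
    w ++ (t ++ t)  ≈⟨ ++-congˡ w (reflection-involutive r) ⟩
    w ++ []        ≡⟨ ++-identityʳ w ⟩
    w ∎

  private
    -- Conjugation by t fixes t, so the count for w t is the count for w plus that of t itself,
    -- which is odd.
    N-flip : ∀ w {t} → IsReflection t → N (w ++ t) t ≡ not (N w t)
    N-flip w {t} r@(v , s , p) = trans (N-++ w t t) (trans (cong₂ _xor_ (N-congʳ w tt) self) (xor-comm (N w t) true))
      where
      tt : (t ++ (t ++ reverse t)) ~ t
      tt = ~trans (++-congˡ t (inverseʳ t)) (≡⇒~ (++-identityʳ t))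
      self : N t t ≡ true
      self = trans (N-congˡ t p) (trans (N-congʳ (v ++ s ∷ reverse v) p) (N-self v s))

    N-true : ∀ w {t} → N w t ≡ true → ℓ (w ++ t) < ℓ w
    N-true w {t} e with reducedWord w
    ... | v , p , f with N⇒Del v t (trans (N-congˡ t p) e)
    ...   | v′ , d , q = subst (ℓ (w ++ t) <_) (trans (sym (Del-length d)) f)
                           (s≤s (ℓ≤length (~trans (~sym q) (++-congʳ t p))))

  -- If the count for w were even, the one for w t would be odd, and deleting a letter from a
  -- reduced word of w t would make w = w t t shorter than w t. The word w itself is arbitrary, so
  -- it can be prescribed by the caller.
  strongExchange : ∀ w {t} → IsReflection t → ℓ (w ++ t) < ℓ w → ∃ λ w′ → Del w w′ × (w ++ t) ~ w′
  strongExchange w {t} r lt with N w t in e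
  ... | true  = N⇒Del w t e
  ... | false = ⊥-elim (<-asym lt (subst (_< ℓ (w ++ t)) (ℓ-cong (++-reflection² w r))
                   (N-true (w ++ t) (trans (N-flip w r) (cong not e)))))

  conj-reflection : ∀ w s → IsReflection (reverse w ++ s ∷ w)
  conj-reflection w s = reverse w , s , ≡⇒~ (cong (λ z → reverse w ++ s ∷ z) (sym (reverse-involutive w)))

  -- Left multiplication by s is right multiplication by the reflection w⁻¹ s w.
  exchange : ∀ s w → ℓ (s ∷ w) < ℓ w → ∃ λ w′ → Del w w′ × (s ∷ w) ~ w′
  exchange s w lt with strongExchange w (conj-reflection w s) (subst (_< ℓ w) (ℓ-cong (~sym (inverseʳ-++ w (s ∷ w)))) lt)
  ... | w′ , d , p = w′ , d , ~trans (~sym (inverseʳ-++ w (s ∷ w))) p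

  generator-reflection : ∀ s → IsReflection [ s ]
  generator-reflection s = [] , s , ~refl

  exchangeʳ : ∀ s w → ℓ (w ++ [ s ]) < ℓ w → ∃ λ w′ → Del w w′ × (w ++ [ s ]) ~ w′
  exchangeʳ s w = strongExchange w (generator-reflection s)

-- Subwords

sublists : {A : Set} → List A → List (List A)
sublists []       = [ [] ]
sublists (x ∷ xs) = map (x ∷_) (sublists xs) ++ sublists xs

data Sub {A : Set} : List A → List A → Set where
  []   : Sub [] []
  _∷_  : ∀ x {xs ys} → Sub xs ys → Sub (x ∷ xs) (x ∷ ys)
  skip : ∀ {x xs ys} → Sub xs ys → Sub xs (x ∷ ys)

Sub-refl : ∀ {A : Set} (xs : List A) → Sub xs xs
Sub-refl []       = []
Sub-refl (x ∷ xs) = x ∷ Sub-refl xs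

Sub-Del : ∀ {A : Set} {xs ys zs : List A} → Del xs zs → Sub xs ys → Sub zs ys
Sub-Del del      (x ∷ p)  = skip p
Sub-Del (keep d) (x ∷ p)  = x ∷ Sub-Del d p
Sub-Del d        (skip p) = skip (Sub-Del d p)

Sub⇒∈ : ∀ {A : Set} {xs ys : List A} → Sub xs ys → xs ∈ sublists ys
Sub⇒∈ []                 = Any.here refl
Sub⇒∈ (x ∷ p)            = ∈-++⁺ˡ (∈-map⁺ (x ∷_) (Sub⇒∈ p))
Sub⇒∈ (skip {x} {ys = ys} p) = ∈-++⁺ʳ (map (x ∷_) (sublists ys)) (Sub⇒∈ p)

-- Bruhat order and its lifting properties

module BruhatOrder (lem : ExcludedMiddle 0ℓ) (S : Set) (m : S → S → Maybe ℕ)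
                   (cox : IsCoxeterMatrix m) (H : S → Set) where

  open Coxeter S m H lem
  open CoxeterGroup lem S m cox H public
  open SetoidReasoning (Group.setoid W)

  ≤B-respˡ : ∀ {u u′ w} → u ~ u′ → u′ ≤B w → u ≤B w
  ≤B-respˡ p (br-refl q)       = br-refl (~trans p q)
  ≤B-respˡ p (br-step t r l q) = br-step t r
    (<⇒LenLt (subst₂ _<_ (ℓ-cong (~sym p)) (ℓ-cong (++-congʳ t (~sym p))) (LenLt⇒< l)))
    (≤B-respˡ (++-congʳ t p) q)

  ≤B-trans : ∀ {u v w} → u ≤B v → v ≤B w → u ≤B w
  ≤B-trans (br-refl p)       q = ≤B-respˡ p q
  ≤B-trans (br-step t r l p) q = br-step t r l (≤B-trans p q)

  ≤B-respʳ : ∀ {u w w′} → w ~ w′ → u ≤B w → u ≤B w′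
  ≤B-respʳ p q = ≤B-trans q (br-refl p)

  ≤B⇒~⊎< : ∀ {u w} → u ≤B w → (u ~ w) ⊎ (ℓ u < ℓ w)
  ≤B⇒~⊎< (br-refl p) = inj₁ p
  ≤B⇒~⊎< (br-step t r l q) with ≤B⇒~⊎< q
  ... | inj₁ p  = inj₂ (subst (_ <_) (ℓ-cong p) (LenLt⇒< l))
  ... | inj₂ lt = inj₂ (<-trans (LenLt⇒< l) lt)

  ≤B⇒ℓ≤ : ∀ {u w} → u ≤B w → ℓ u ≤ ℓ w
  ≤B⇒ℓ≤ p with ≤B⇒~⊎< p
  ... | inj₁ q  = ≤-reflexive (ℓ-cong q)
  ... | inj₂ lt = <⇒≤ lt

  ≤B-antisym : ∀ {u w} → u ≤B w → w ≤B u → u ~ w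
  ≤B-antisym p q with ≤B⇒~⊎< p
  ... | inj₁ r  = r
  ... | inj₂ lt = ⊥-elim (<⇒≱ lt (≤B⇒ℓ≤ q))

  <⇒≁ : ∀ {u w} → ℓ u < ℓ w → ¬ (u ~ w)
  <⇒≁ lt p = <⇒≢ lt (ℓ-cong p)

  ∷-cancel : ∀ s {u v} → (s ∷ u) ~ (s ∷ v) → u ~ v
  ∷-cancel s p = ~trans (~sym (cancel s _)) (~trans (∷-cong s p) (cancel s _))

  ∷-swap : ∀ s {u v} → u ~ (s ∷ v) → (s ∷ u) ~ v
  ∷-swap s p = ~trans (∷-cong s p) (cancel s _)

  ascent-≤B : ∀ {s w} → ℓ w < ℓ (s ∷ w) → w ≤B (s ∷ w)
  ascent-≤B {s} {w} lt =
    br-step (reverse w ++ s ∷ w) (conj-reflection w s)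
      (<⇒LenLt (subst (ℓ w <_) (ℓ-cong (~sym eq)) lt)) (br-refl eq)
    where
    eq : (w ++ (reverse w ++ s ∷ w)) ~ (s ∷ w)
    eq = inverseʳ-++ w (s ∷ w)

  descent-≤B : ∀ {s w} → ℓ (s ∷ w) < ℓ w → (s ∷ w) ≤B w
  descent-≤B {s} {w} lt = ≤B-respʳ (cancel s w)
    (ascent-≤B (subst (ℓ (s ∷ w) <_) (ℓ-cong (~sym (cancel s w))) lt))

  -- If s raises u t, lengths decide. Otherwise a reduced word of u t starts with s, and multiplying
  -- by t deletes one of its letters: the leading s, which gives s u = u t, or a later one, which
  -- makes s u shorter than s u t.
  lift-step : ∀ s u {t} → IsReflection t → ℓ u < ℓ (u ++ t) →
    ((s ∷ u) ~ (u ++ t)) ⊎ (ℓ (s ∷ u) < ℓ (s ∷ (u ++ t)))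
  lift-step s u {t} r lt with ascent-or-descent s (u ++ t) | reducedWord (s ∷ (u ++ t))
  ... | inj₁ up   | _ = inj₂ (≤-<-trans (≤-trans (ℓ-∷-≤ s u) lt) up)
  ... | inj₂ down | v , p , e = compare (strongExchange (s ∷ v) r
          (subst₂ _<_ (ℓ-cong (~sym back)) (ℓ-cong (~sym (∷-swap s p))) lt))
    where
    back : ((s ∷ v) ++ t) ~ u
    back = ~trans (++-congʳ t (∷-swap s p)) (++-reflection² u r)
    compare : (∃ λ w → Del (s ∷ v) w × ((s ∷ v) ++ t) ~ w) →
      ((s ∷ u) ~ (u ++ t)) ⊎ (ℓ (s ∷ u) < ℓ (s ∷ (u ++ t)))
    compare (_ , del , q)    = inj₁ (~trans (∷-cong s (~trans (~sym back) q)) (∷-swap s p))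
    compare (_ , keep d , q) = inj₂ (≤-<-trans (ℓ≤length (~sym (∷-swap s (~trans (~sym back) q))))
                                               (≤-reflexive (trans (sym (Del-length d)) e)))

  -- Multiply the chain from u to w by s edge by edge; at an edge with s u = u t the unmultiplied
  -- rest of the chain takes over.
  lift-or-≤ : ∀ s {u w} → u ≤B w → ((s ∷ u) ≤B (s ∷ w)) ⊎ ((s ∷ u) ≤B w)
  lift-or-≤ s (br-refl p) = inj₁ (br-refl (∷-cong s p))
  lift-or-≤ s {u} (br-step t r l q) with lift-step s u r (LenLt⇒< l)
  ... | inj₁ p = inj₂ (≤B-respˡ p q)
  ... | inj₂ lt with lift-or-≤ s q
  ...   | inj₁ q′ = inj₁ (br-step t r (<⇒LenLt lt) q′)
  ...   | inj₂ q′ = inj₂ (br-step t r (<⇒LenLt lt) q′)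

  -- The same walk, switched the other way: at an edge with s u = u t one has u = s u t, which is
  -- the bottom of the multiplied rest of the chain.
  lift-or-≥ : ∀ s {u w} → u ≤B w → ((s ∷ u) ≤B (s ∷ w)) ⊎ (u ≤B (s ∷ w))
  lift-or-≥ s (br-refl p) = inj₁ (br-refl (∷-cong s p))
  lift-or-≥ s {u} (br-step t r l q) with lift-or-≥ s q
  ... | inj₂ q′ = inj₂ (br-step t r l q′)
  ... | inj₁ q′ with lift-step s u r (LenLt⇒< l)
  ...   | inj₂ lt = inj₁ (br-step t r (<⇒LenLt lt) q′)
  ...   | inj₁ p  = inj₂ (≤B-respˡ (~sym (~trans (∷-cong s (~sym p)) (cancel s u))) q′)

  lift-top-descent : ∀ {s u w} → ℓ (s ∷ w) < ℓ w → u ≤B w → (s ∷ u) ≤B w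
  lift-top-descent {s} lt p with lift-or-≤ s p
  ... | inj₁ q = ≤B-trans q (descent-≤B lt)
  ... | inj₂ q = q

  lift-top-ascent : ∀ {s u w} → ℓ w < ℓ (s ∷ w) → u ≤B w → (s ∷ u) ≤B (s ∷ w)
  lift-top-ascent {s} lt p with lift-or-≤ s p
  ... | inj₁ q = q
  ... | inj₂ q = ≤B-trans q (ascent-≤B lt)

  lift-bottom-descent : ∀ {s u w} → ℓ (s ∷ u) < ℓ u → u ≤B w → (s ∷ u) ≤B (s ∷ w)
  lift-bottom-descent {s} lt p with lift-or-≥ s p
  ... | inj₁ q = q
  ... | inj₂ q = ≤B-trans (descent-≤B lt) q

  lift-bottom-ascent : ∀ {s u w} → ℓ u < ℓ (s ∷ u) → u ≤B w → u ≤B (s ∷ w)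
  lift-bottom-ascent {s} lt p with lift-or-≥ s p
  ... | inj₁ q = ≤B-trans (ascent-≤B lt) q
  ... | inj₂ q = q

  -- Since (u t)⁻¹ = u⁻¹ (u t u⁻¹), inversion sends edges to edges. It carries lifting over to right
  -- multiplication.
  reverse-≤B : ∀ {u w} → u ≤B w → reverse u ≤B reverse w
  reverse-≤B (br-refl p) = br-refl (reverse-cong p)
  reverse-≤B {u} (br-step t r@(v , s , p) l q) =
    br-step t′ r′ (<⇒LenLt (subst₂ _<_ (sym (ℓ-reverse u)) (trans (sym (ℓ-reverse (u ++ t))) (ℓ-cong eq)) (LenLt⇒< l)))
      (≤B-respˡ (~sym eq) (reverse-≤B q))
    where
    t′ = (u ++ v) ++ s ∷ reverse (u ++ v)
    r′ : IsReflection t′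
    r′ = u ++ v , s , ~refl
    reverse-t : reverse t ~ (v ++ s ∷ reverse v)
    reverse-t = ~trans (reverse-cong p) (≡⇒~ (trans (reverse-++ v (s ∷ reverse v))
      (trans (cong (_++ reverse v) (trans (unfold-reverse s (reverse v)) (cong (_++ [ s ]) (reverse-involutive v))))
             (++-assoc v [ s ] (reverse v)))))
    eq : reverse (u ++ t) ~ (reverse u ++ t′)
    eq = begin
      reverse (u ++ t)                                        ≡⟨ reverse-++ u t ⟩
      reverse t ++ reverse u                                  ≈⟨ ++-congʳ (reverse u) reverse-t ⟩
      (v ++ s ∷ reverse v) ++ reverse u                       ≡⟨ ++-assoc v _ _ ⟩
      v ++ s ∷ (reverse v ++ reverse u)                       ≡⟨ cong (λ z → v ++ s ∷ z) (reverse-++ u v) ⟨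
      v ++ s ∷ reverse (u ++ v)                               ≈⟨ inverseˡ-++ u _ ⟨
      reverse u ++ (u ++ (v ++ s ∷ reverse (u ++ v)))         ≡⟨ cong (reverse u ++_) (++-assoc u v _) ⟨
      reverse u ++ t′ ∎

  lift-bottom-ascentʳ : ∀ {h u w} → ℓ u < ℓ (u ++ [ h ]) → u ≤B w → u ≤B (w ++ [ h ])
  lift-bottom-ascentʳ {h} {u} {w} lt p =
    subst₂ _≤B_ (reverse-involutive u)
      (trans (cong reverse (sym (reverse-++ w [ h ]))) (reverse-involutive (w ++ [ h ])))
      (reverse-≤B (lift-bottom-ascent
        (subst₂ _<_ (sym (ℓ-reverse u)) (trans (sym (ℓ-reverse (u ++ [ h ]))) (cong ℓ (reverse-++ u [ h ]))) lt)
        (reverse-≤B p)))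

  leftDescent : ∀ {w} → ¬ (w ~ []) → ∃ λ s → ℓ (s ∷ w) < ℓ w
  leftDescent {w} w≁[] with reducedWord w
  ... | []    , p , _ = ⊥-elim (w≁[] (~sym p))
  ... | s ∷ v , p , e = s , subst (ℓ (s ∷ w) <_) e (s≤s (ℓ≤length (~sym (∷-swap s (~sym p)))))

  []-≤B : ∀ w → [] ≤B w
  []-≤B w = <-rec (λ n → ∀ v → ℓ v ≡ n → [] ≤B v) go (ℓ w) w refl
    where
    go : ∀ n → (∀ {k} → k < n → ∀ v → ℓ v ≡ k → [] ≤B v) → ∀ v → ℓ v ≡ n → [] ≤B v
    go n ih v refl with lem {v ~ []}
    ... | yes p = br-refl (~sym p)
    ... | no ¬p with leftDescent ¬p
    ...   | s , lt = ≤B-trans (ih lt (s ∷ v) refl) (descent-≤B lt)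

  -- Each edge downwards deletes a letter by strong exchange. Hence everything below w is spelled by
  -- one of the finitely many subwords of w.
  ≤B⇒Sub : ∀ {u w} → u ≤B w → ∃ λ v → u ~ v × Sub v w
  ≤B⇒Sub (br-refl {w = w} p) = w , p , Sub-refl w
  ≤B⇒Sub {u} (br-step t r l q) with ≤B⇒Sub q
  ... | v , p , sub with strongExchange v r
          (subst₂ _<_ (ℓ-cong (~trans (~sym (++-reflection² u r)) (++-congʳ t p))) (ℓ-cong p) (LenLt⇒< l))
  ...   | v′ , d , p′ = v′ , ~trans (~trans (~sym (++-reflection² u r)) (++-congʳ t p)) p′ , Sub-Del d sub

  -- Minimal coset representatives

  InWH-ascent : ∀ {w h} → InWH w → H h → ℓ w < ℓ (w ++ [ h ])
  InWH-ascent p hh = LenLt⇒< (p _ hh)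

  mkInWH : ∀ {w} → (∀ h → H h → ¬ (ℓ (w ++ [ h ]) < ℓ w)) → InWH w
  mkInWH {w} f h hh with ascent-or-descent h (reverse w)
                       | trans (cong ℓ (sym (reverse-++ w [ h ]))) (ℓ-reverse (w ++ [ h ]))
  ... | inj₁ lt | e = <⇒LenLt (subst₂ _<_ (ℓ-reverse w) e lt)
  ... | inj₂ lt | e = ⊥-elim (f h hh (subst₂ _<_ e (ℓ-reverse w) lt))

  ¬InWH⇒descent : ∀ {w} → ¬ InWH w → ∃ λ h → H h × ℓ (w ++ [ h ]) < ℓ w
  ¬InWH⇒descent {w} ¬p with lem {∃ λ h → H h × ℓ (w ++ [ h ]) < ℓ w}
  ... | yes q = q
  ... | no ¬q = ⊥-elim (¬p (mkInWH λ h hh lt → ¬q (h , hh , lt)))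

  InWH-cong : ∀ {u w} → u ~ w → InWH u → InWH w
  InWH-cong p q h hh = <⇒LenLt (subst₂ _<_ (ℓ-cong p) (ℓ-cong (++-congʳ [ h ] p)) (InWH-ascent q hh))

  InWH-[] : InWH []
  InWH-[] = mkInWH λ h _ lt → n≮0 (subst (ℓ [ h ] <_) ℓ[]≡0 lt)

  -- If x h were shorter than x, then v x h would be no longer than v x, because lengths add up in v
  -- x.
  InWH-suffix : ∀ v {x} → length v + ℓ x ≤ ℓ (v ++ x) → InWH (v ++ x) → InWH x
  InWH-suffix v {x} e p = mkInWH λ h hh lt → <⇒≱ (InWH-ascent p hh)
    (≤-trans (≤-reflexive (cong ℓ (++-assoc v x [ h ])))
    (≤-trans (ℓ-++-≤ v (x ++ [ h ])) (≤-trans (+-monoʳ-≤ (length v) (<⇒≤ lt)) e)))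

  InWH-descent : ∀ {s x} → ℓ (s ∷ x) < ℓ x → InWH x → InWH (s ∷ x)
  InWH-descent {s} {x} lt p = InWH-suffix [ s ] (subst (suc (ℓ (s ∷ x)) ≤_) (ℓ-cong (~sym (cancel s x))) lt)
                                         (InWH-cong (~sym (cancel s x)) p)

  InWH-~ʳ : ∀ {x y h} → InWH x → H h → y ~ (x ++ [ h ]) → ¬ InWH y
  InWH-~ʳ {x} {y} {h} p hh e q = <-asym (InWH-ascent p hh)
    (subst₂ _<_ (ℓ-cong e) (ℓ-cong (~trans (++-congʳ [ h ] e) (++-reflection² x (generator-reflection h)))) (InWH-ascent q hh))

  -- Deodhar's lemma. A descent h of s x comes from deleting a letter of s v, with v a reduced word
  -- of x. Deleting inside v would make x h shorter than x, so the deleted letter is s and s x h =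
  -- x.
  deodhar : ∀ {s x} → InWH x → ¬ InWH (s ∷ x) → ∃ λ h → H h × (s ∷ x) ~ (x ++ [ h ])
  deodhar {s} {x} p ¬q with ¬InWH⇒descent ¬q | reducedWord x
  ... | h , hh , lt | v , v~x , e with exchangeʳ h (s ∷ v)
          (subst₂ _<_ (ℓ-cong (∷-cong s (++-congʳ [ h ] (~sym v~x)))) (ℓ-cong (∷-cong s (~sym v~x))) lt)
  ...   | _ , del , r = h , hh , (begin
            s ∷ x                                  ≈⟨ ++-reflection² (s ∷ x) (generator-reflection h) ⟨
            ((s ∷ x) ++ [ h ]) ++ [ h ]            ≈⟨ ++-congʳ [ h ] (~trans (++-congʳ [ h ] (∷-cong s (~sym v~x))) (~trans r v~x)) ⟩
            x ++ [ h ] ∎)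
  ...   | _ , keep {ys = v′} d , r = ⊥-elim (<-asym (InWH-ascent p hh)
            (≤-<-trans (ℓ≤length (~trans (~sym (∷-cancel s r)) (++-congʳ [ h ] v~x)))
                       (≤-reflexive (trans (sym (Del-length d)) e))))

  -- Left multiplication maps as special partial matchings

  data LamView (s : S) (x y : Word) : Set where
    moves : InWH (s ∷ x) → y ≡ s ∷ x → LamView s x y
    stays : ¬ InWH (s ∷ x) → y ≡ x → LamView s x y

  -- Confines the case split on `lem` hidden in `lamH`; afterwards only words are compared, never
  -- membership proofs.
  lamView : ∀ s u → LamView s (proj₁ u) (proj₁ (lamH s u))
  lamView s (x , _) with lem {InWH (s ∷ x)}
  ... | yes p = moves p refl
  ... | no ¬p = stays ¬p refl

  lam-moves : ∀ {s} u → InWH (s ∷ proj₁ u) → proj₁ (lamH s u) ≡ s ∷ proj₁ u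
  lam-moves {s} u p with lamView s u
  ... | moves _ e = e
  ... | stays ¬p _ = ⊥-elim (¬p p)

  lam-stays : ∀ {s} u → ¬ InWH (s ∷ proj₁ u) → proj₁ (lamH s u) ≡ proj₁ u
  lam-stays {s} u ¬p with lamView s u
  ... | moves p _ = ⊥-elim (¬p p)
  ... | stays _ e = e

  stays⇒ascent : ∀ {s x} → InWH x → ¬ InWH (s ∷ x) → ℓ x < ℓ (s ∷ x)
  stays⇒ascent {s} {x} p ¬q with ascent-or-descent s x
  ... | inj₁ lt = lt
  ... | inj₂ lt = ⊥-elim (¬q (InWH-descent lt p))

  ⋖-length : ∀ (x y : WH) → proj₁ x ≤B proj₁ y → ℓ (proj₁ y) ≡ suc (ℓ (proj₁ x)) → x ⋖ y
  ⋖-length a@(x , _) b@(y , _) p e = (p , <⇒≁ lt) , between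
    where
    lt : ℓ x < ℓ y
    lt = ≤-reflexive (sym e)
    between : ∀ z → a <ₚ z → z <ₚ b → ⊥
    between (z , _) (x≤z , x≁z) (z≤y , z≁y) with ≤B⇒~⊎< x≤z | ≤B⇒~⊎< z≤y
    ... | inj₁ q  | _      = x≁z q
    ... | inj₂ _  | inj₁ q = z≁y q
    ... | inj₂ l₁ | inj₂ l₂ = <⇒≱ (subst (ℓ z <_) e l₂) l₁

  ⋖⇒< : ∀ x y → x ⋖ y → ℓ (proj₁ x) < ℓ (proj₁ y)
  ⋖⇒< _ _ ((p , ne) , _) with ≤B⇒~⊎< p
  ... | inj₁ q  = ⊥-elim (ne q)
  ... | inj₂ lt = lt

  -- No fourth case: if s x is shorter than x, then s x is a length-additive suffix of x = s (s x),
  -- hence in W^H.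
  data Position (s : S) (x : Word) : Set where
    raises : InWH (s ∷ x) → ℓ x < ℓ (s ∷ x) → Position s x
    lowers : InWH (s ∷ x) → ℓ (s ∷ x) < ℓ x → Position s x
    fixes  : ¬ InWH (s ∷ x) → ℓ x < ℓ (s ∷ x) → Position s x

  position : ∀ s {x} → InWH x → Position s x
  position s {x} p with lem {InWH (s ∷ x)} | ascent-or-descent s x
  ... | yes q | inj₁ lt = raises q lt
  ... | _     | inj₂ lt = lowers (InWH-descent lt p) lt
  ... | no ¬q | inj₁ lt = fixes ¬q lt

  lam-⋗ : ∀ {s} u → InWH (s ∷ proj₁ u) → ℓ (proj₁ u) < ℓ (s ∷ proj₁ u) → u ⋖ lamH s u
  lam-⋗ {s} u p lt = ⋖-length u (lamH s u) (subst (proj₁ u ≤B_) (sym e) (ascent-≤B lt)) (trans (cong ℓ e) (ascent⇒suc lt))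
    where e = lam-moves u p

  lam-⋖ : ∀ {s} u → ℓ (s ∷ proj₁ u) < ℓ (proj₁ u) → lamH s u ⋖ u
  lam-⋖ {s} u lt = ⋖-length (lamH s u) u (subst (_≤B proj₁ u) (sym e) (descent-≤B lt)) (trans (descent⇒suc lt) (cong suc (cong ℓ (sym e))))
    where e = lam-moves u (InWH-descent lt (proj₂ u))

  lam-⋖⇒descent : ∀ {s} u → lamH s u ⋖ u → ℓ (s ∷ proj₁ u) < ℓ (proj₁ u)
  lam-⋖⇒descent {s} u c with lamView s u
  ... | moves _ e = subst (λ z → ℓ z < ℓ (proj₁ u)) e (⋖⇒< (lamH s u) u c)
  ... | stays _ e = ⊥-elim (<-irrefl (cong ℓ e) (⋖⇒< (lamH s u) u c))

  lam-cong : ∀ s {x y} → proj₁ x ~ proj₁ y → proj₁ (lamH s x) ~ proj₁ (lamH s y)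
  lam-cong s {x} {y} p with lamView s x | lamView s y
  ... | moves _ e | moves _ e′ = subst₂ _~_ (sym e) (sym e′) (∷-cong s p)
  ... | stays _ e | stays _ e′ = subst₂ _~_ (sym e) (sym e′) p
  ... | moves q _ | stays ¬q _ = ⊥-elim (¬q (InWH-cong (∷-cong s p) q))
  ... | stays ¬q _ | moves q _ = ⊥-elim (¬q (InWH-cong (∷-cong s (~sym p)) q))

  lam-involutive : ∀ s x → proj₁ (lamH s (lamH s x)) ~ proj₁ x
  lam-involutive s x with lamView s x
  ... | stays _ e = ~trans (lam-cong s {lamH s x} {x} (≡⇒~ e)) (≡⇒~ e)
  ... | moves p e = ~trans (≡⇒~ (lam-moves (lamH s x) q)) (~trans (∷-cong s (≡⇒~ e)) (cancel s (proj₁ x)))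
    where
    q : InWH (s ∷ proj₁ (lamH s x))
    q = InWH-cong (~trans (~sym (cancel s (proj₁ x))) (∷-cong s (≡⇒~ (sym e)))) (proj₂ x)

  lam-qspm : ∀ {s} (w : WH) → ℓ (s ∷ proj₁ w) < ℓ (proj₁ w) → IsQSPM (Below w) (lamH s)
  lam-qspm {s} w desc = record
    { resp   = λ x y _ _ → lam-cong s {x} {y}
    ; closed = closed
    ; invol  = λ x _ → lam-involutive s x
    ; trich  = trich
    ; lift   = λ x y _ _ → lift x y
    }
    where
    closed : ∀ x → Below w x → Below w (lamH s x)
    closed x x≤w with lamView s x
    ... | moves _ e = subst (_≤B proj₁ w) (sym e) (lift-top-descent desc x≤w)
    ... | stays _ e = subst (_≤B proj₁ w) (sym e) x≤w
    trich : ∀ x → Below w x → (lamH s x ⋖ x) ⊎ (lamH s x ≈H x) ⊎ (x ⋖ lamH s x)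
    trich x _ with position s (proj₂ x)
    ... | raises p lt = inj₂ (inj₂ (lam-⋗ x p lt))
    ... | lowers _ lt = inj₁ (lam-⋖ x lt)
    ... | fixes ¬p _  = inj₂ (inj₁ (≡⇒~ (lam-stays x ¬p)))
    lift : ∀ x y → x ⋖ y → ¬ (lamH s x ≈H y) → lamH s x <ₚ lamH s y
    lift x@(X , pX) y@(Y , pY) x⋖y@((X≤Y , X≁Y) , no-between) ne =
      cases (position s pX) (position s pY)
      where
      strict : ∀ {a b} → proj₁ (lamH s x) ≡ a → proj₁ (lamH s y) ≡ b → a ≤B b → ¬ (a ~ b) → lamH s x <ₚ lamH s y
      strict refl refl p q = p , q
      cases : Position s X → Position s Y → lamH s x <ₚ lamH s y
      cases (lowers p lt) (raises q _) =
        strict (lam-moves x p) (lam-moves y q) (lift-bottom-descent lt X≤Y) λ e → X≁Y (∷-cancel s e)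
      cases (lowers p lt) (lowers q _) =
        strict (lam-moves x p) (lam-moves y q) (lift-bottom-descent lt X≤Y) λ e → X≁Y (∷-cancel s e)
      cases (lowers p lt) (fixes ¬q _) =
        strict (lam-moves x p) (lam-stays y ¬q) (≤B-trans (descent-≤B lt) X≤Y) (<⇒≁ (<-trans lt (⋖⇒< x y x⋖y)))
      cases (raises p _) (raises q lt) =
        strict (lam-moves x p) (lam-moves y q) (lift-top-ascent lt X≤Y) λ e → X≁Y (∷-cancel s e)
      -- Lifting gives X ≤ s Y < Y, so the cover forces X = s Y, that is s X = Y, which is excluded.
      -- Only here is a cover needed rather than X < Y.
      cases (raises p lt) (lowers q lt′) with lem {X ~ (s ∷ Y)}
      ... | yes r = ⊥-elim (ne (~trans (≡⇒~ (lam-moves x p)) (∷-swap s r)))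
      ... | no ¬r = ⊥-elim (no-between (s ∷ Y , q) (lift-bottom-ascent lt X≤Y , ¬r) (descent-≤B lt′ , <⇒≁ lt′))
      -- Here s Y = Y h. From s X ≤ s Y = Y h, lifting on the right along h gives s X ≤ Y, because h
      -- is not a descent of s X.
      cases (raises p _) (fixes ¬q lt) with deodhar pY ¬q
      ... | h , hh , r = strict (lam-moves x p) (lam-stays y ¬q)
              (≤B-respʳ (~trans (++-congʳ [ h ] r) (++-reflection² Y (generator-reflection h)))
                (lift-bottom-ascentʳ (InWH-ascent p hh) (lift-top-ascent lt X≤Y)))
              (λ e → ne (~trans (≡⇒~ (lam-moves x p)) e))
      cases (fixes ¬p _) (raises q lt) =
        strict (lam-stays x ¬p) (lam-moves y q) (≤B-trans X≤Y (ascent-≤B lt)) (<⇒≁ (<-trans (⋖⇒< x y x⋖y) lt))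
      -- Equality X = s Y would give s X = Y, an element of W^H.
      cases (fixes ¬p lt) (lowers q _) =
        strict (lam-stays x ¬p) (lam-moves y q) (lift-bottom-ascent lt X≤Y) λ e → ¬p (InWH-cong (~sym (∷-swap s e)) pY)
      cases (fixes ¬p _) (fixes ¬q _) = strict (lam-stays x ¬p) (lam-stays y ¬q) X≤Y X≁Y

  -- The pircon W^H

  ≤H-isPartialOrder : IsPartialOrder _≈H_ _≤H_
  ≤H-isPartialOrder = record
    { isPreorder = record
      { isEquivalence = record { refl = ~refl ; sym = ~sym ; trans = ~trans }
      ; reflexive = br-refl
      ; trans = ≤B-trans }
    ; antisym = ≤B-antisym }

  bottom : WH
  bottom = [] , InWH-[]

  ~[]⇒Minimal : ∀ w → proj₁ w ~ [] → Minimal w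
  ~[]⇒Minimal w p y y≤w = ≤B-antisym y≤w (≤B-respˡ p ([]-≤B (proj₁ y)))

  ¬Minimal⇒≁[] : ∀ w → ¬ Minimal w → ¬ (proj₁ w ~ [])
  ¬Minimal⇒≁[] w ¬min p = ¬min (~[]⇒Minimal w p)

  ≁[]⇒¬Minimal : ∀ w → ¬ (proj₁ w ~ []) → ¬ Minimal w
  ≁[]⇒¬Minimal w w≁[] min = w≁[] (~sym (min bottom ([]-≤B (proj₁ w))))

  filterWH : List Word → List WH
  filterWH []       = []
  filterWH (v ∷ vs) with lem {InWH v}
  ... | yes p = (v , p) ∷ filterWH vs
  ... | no _  = filterWH vs

  filterWH⁺ : ∀ (x : WH) {v} → proj₁ x ~ v → ∀ {vs} → v ∈ vs → Any (x ≈H_) (filterWH vs)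
  filterWH⁺ x e {v ∷ vs} (Any.here refl) with lem {InWH v}
  ... | yes p = Any.here e
  ... | no ¬p = ⊥-elim (¬p (InWH-cong e (proj₂ x)))
  filterWH⁺ x e {v ∷ vs} (Any.there i) with lem {InWH v}
  ... | yes p = Any.there (filterWH⁺ x e i)
  ... | no _  = filterWH⁺ x e i

  finite-below : ∀ w → Finite (Below w)
  finite-below w = filterWH (sublists (proj₁ w)) , λ x x≤w →
    let (_ , e , sub) = ≤B⇒Sub x≤w in filterWH⁺ x e (Sub⇒∈ sub)

  lam-spm : ∀ {s} w → ℓ (s ∷ proj₁ w) < ℓ (proj₁ w) → IsSPM w (lamH s)
  lam-spm w lt = lam-qspm w lt , lam-⋖ w lt

  isPircon : IsPircon
  isPircon = ≤H-isPartialOrder , (bottom , λ x → []-≤B (proj₁ x)) ,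
    λ x ¬min → finite-below x , let (s , lt) = leftDescent (¬Minimal⇒≁[] x ¬min) in lamH s , lam-spm x lt

-- Lets later case splits distinguish a given generator from the other one instead of `true` from
-- `false`.
bool-cover : (P : Bool → Set) (b : Bool) → P b → P (not b) → ∀ c → P c
bool-cover P true  p q true  = p
bool-cover P true  p q false = q
bool-cover P false p q true  = q
bool-cover P false p q false = p

-- Cosets of rank-two parabolic subgroups

module Dihedral (lem : ExcludedMiddle 0ℓ) (S : Set) (m : S → S → Maybe ℕ)
                (cox : IsCoxeterMatrix m) (H : S → Set) (g : Bool → S) where

  open Coxeter S m H lem
  open BruhatOrder lem S m cox H

  letter : Bool → ℕ → Bool
  letter b zero    = b
  letter b (suc k) = not (letter b k)

  -- The alternating word with k letters whose rightmost letter is b.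
  alternating : Bool → ℕ → List Bool
  alternating b zero    = []
  alternating b (suc k) = letter b k ∷ alternating b k

  ρ : Bool → ℕ → Word
  ρ b k = map g (alternating b k)

  letter-not : ∀ b k → letter (not b) k ≡ not (letter b k)
  letter-not b zero    = refl
  letter-not b (suc k) = cong not (letter-not b k)

  length-alternating : ∀ b k → length (alternating b k) ≡ k
  length-alternating b zero    = refl
  length-alternating b (suc k) = cong suc (length-alternating b k)

  length-ρ : ∀ b k → length (ρ b k) ≡ k
  length-ρ b k = trans (length-map g (alternating b k)) (length-alternating b k)

  alternating-snoc : ∀ b k → alternating b (suc k) ≡ alternating (not b) k ++ [ b ]
  alternating-snoc b zero    = refl
  alternating-snoc b (suc k) = cong₂ _∷_ (sym (letter-not b k)) (alternating-snoc b k)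

  ρ-snoc : ∀ b k → ρ b (suc k) ≡ ρ (not b) k ++ [ g b ]
  ρ-snoc b k = trans (cong (map g) (alternating-snoc b k)) (map-++ g (alternating (not b) k) [ b ])

  ρ-flip : ∀ b k → g (letter b (suc k)) ∷ ρ (not b) k ≡ ρ (not b) (suc k)
  ρ-flip b k = cong (λ c → g c ∷ ρ (not b) k) (sym (letter-not b k))

  ρ-drop : ∀ b k → (g (letter b (suc (suc k))) ∷ ρ b (suc k)) ~ (g (letter b k) ∷ g (letter b k) ∷ ρ b k)
  ρ-drop b k = ≡⇒~ (cong (λ c → g c ∷ ρ b (suc k)) (not-involutive (letter b k)))

  -- The reverse inequality holds for every word.
  Reduced : Word → Set
  Reduced w = length w ≤ ℓ w

  Reduced-tail : ∀ {s w} → Reduced (s ∷ w) → Reduced w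
  Reduced-tail {s} {w} r = ≤-pred (≤-trans r (ℓ-∷-≤ s w))

  Reduced-ρ-≤ : ∀ b {j k} → j ≤ k → Reduced (ρ b k) → Reduced (ρ b j)
  Reduced-ρ-≤ b {j} {zero}  z≤n r = r
  Reduced-ρ-≤ b {j} {suc k} j≤k r with m≤n⇒m<n∨m≡n j≤k
  ... | inj₁ j<k  = Reduced-ρ-≤ b (≤-pred j<k) (Reduced-tail r)
  ... | inj₂ refl = r

  ¬Reduced-∷∷ : ∀ s w → ¬ Reduced (s ∷ s ∷ w)
  ¬Reduced-∷∷ s w r = <⇒≱ (≤-trans (n≤1+n _) r) (ℓ≤length (~sym (cancel s w)))

  -- Two equal neighbours would cancel.
  Reduced⇒alternating : ∀ v → Reduced (map g v) → ∃ λ b → v ≡ alternating b (length v)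
  Reduced⇒alternating []      r = true , refl
  Reduced⇒alternating (a ∷ v) r with Reduced⇒alternating v (Reduced-tail r)
  ... | b , e = go v e r
    where
    go : ∀ v → v ≡ alternating b (length v) → Reduced (g a ∷ map g v) →
         ∃ λ c → a ∷ v ≡ alternating c (suc (length v))
    -- The letter b found for the empty tail is arbitrary and is discarded: a is now the rightmost
    -- letter.
    go []      _ _ = a , refl
    go (c ∷ v) e r with a Bool.≟ letter b (length v)
    ... | yes refl = ⊥-elim (¬Reduced-∷∷ _ _ (subst (λ z → Reduced (g a ∷ map g z)) e r))
    ... | no ne = b , cong₂ _∷_ (¬-not ne) e

  -- Exchange only deletes letters, so reducing never leaves the two generators.
  reduceWord : ∀ v → ∃ λ v′ → Reduced (map g v′) × map g v ~ map g v′
  reduceWord []      = [] , z≤n , ~refl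
  reduceWord (a ∷ v) with reduceWord v
  ... | v′ , r , p with ascent-or-descent (g a) (map g v′)
  ...   | inj₁ lt = a ∷ v′ , ≤-trans (s≤s r) lt , ∷-cong (g a) p
  ...   | inj₂ lt with exchange (g a) (map g v′) lt
  ...     | w , d , q with Del-map g v′ d
  ...       | v″ , _ , refl = v″ ,
              ≤-pred (≤-trans (≤-reflexive (sym (Del-length d))) (≤-trans r (≤-trans (≤-reflexive (descent⇒suc lt)) (s≤s (≤-reflexive (ℓ-cong q)))))) ,
              ~trans (∷-cong (g a) p) q

  CosetMin : Word → Set
  CosetMin x = ∀ v → ℓ x ≤ ℓ (map g v ++ x)

  map-conj-++ : ∀ u v x → (reverse (map g u) ++ (map g v ++ x)) ≡ map g (reverse u ++ v) ++ x
  map-conj-++ u v x = trans (sym (++-assoc (reverse (map g u)) (map g v) x))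
    (cong (_++ x) (trans (cong (_++ map g v) (sym (reverse-map g u))) (sym (map-++ g (reverse u) v))))

  solve-left : ∀ u v x y → (map g u ++ x) ~ (map g v ++ y) → x ~ (map g (reverse u ++ v) ++ y)
  solve-left u v x y p = ~trans (~sym (inverseˡ-++ (map g u) x))
    (~trans (++-congˡ (reverse (map g u)) p) (≡⇒~ (map-conj-++ u v y)))

  cosetMin-exists : ∀ x → ∃₂ λ x₀ v → CosetMin x₀ × x ~ (map g v ++ x₀)
  cosetMin-exists x = <-rec (λ n → ∀ x → ℓ x ≡ n → ∃₂ λ x₀ v → CosetMin x₀ × x ~ (map g v ++ x₀)) go (ℓ x) x refl
    where
    go : ∀ n → (∀ {k} → k < n → ∀ x → ℓ x ≡ k → ∃₂ λ x₀ v → CosetMin x₀ × x ~ (map g v ++ x₀)) →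
         ∀ x → ℓ x ≡ n → ∃₂ λ x₀ v → CosetMin x₀ × x ~ (map g v ++ x₀)
    go n ih x refl with lem {∃ λ v → ℓ (map g v ++ x) < ℓ x}
    ... | no ¬p = x , [] , (λ v → ≮⇒≥ λ lt → ¬p (v , lt)) , ~refl
    ... | yes (v , lt) with ih lt (map g v ++ x) refl
    ...   | x₀ , v₀ , min , p = x₀ , reverse v ++ v₀ , min , solve-left v v₀ x x₀ p

  -- A descent would delete a letter: one in v contradicts reducedness of a v, and one in a reduced
  -- word of x₀ produces a shorter element of the coset.
  additive : ∀ {x₀} → CosetMin x₀ → ∀ v → Reduced (map g v) → length v + ℓ x₀ ≤ ℓ (map g v ++ x₀)
  additive min [] r = ≤-refl
  additive {x₀} min (a ∷ v) r with additive min v (Reduced-tail r) | ascent-or-descent (g a) (map g v ++ x₀)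
  ... | ih | inj₁ lt = ≤-trans (s≤s ih) lt
  ... | ih | inj₂ lt with reducedWord x₀
  ...   | y , y~x₀ , e with exchange (g a) (map g v ++ y)
            (subst₂ _<_ (ℓ-cong (++-congˡ (map g (a ∷ v)) (~sym y~x₀))) (ℓ-cong (++-congˡ (map g v) (~sym y~x₀))) lt)
  ...     | w , d , p with Del-++ (map g v) d
  ...       | inj₁ (v′ , d′ , refl) = ⊥-elim (<⇒≱ (≤-trans (≤-reflexive (sym (Del-length d′))) (≤-trans (n≤1+n _) r))
                (ℓ≤length (~sym (++-cancelʳ y (map g (a ∷ v)) v′ p))))
  ...       | inj₂ (y′ , d′ , refl) = ⊥-elim (<⇒≱
                (≤-trans (s≤s (ℓ≤length y-eq)) (≤-reflexive (trans (sym (Del-length d′)) e)))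
                (min (reverse v ++ a ∷ v)))
    where
    y-eq : y′ ~ (map g (reverse v ++ a ∷ v) ++ x₀)
    y-eq = ~trans (solve-left v (a ∷ v) y′ y (~sym p)) (++-congˡ (map g (reverse v ++ a ∷ v)) y~x₀)

  additive-ρ : ∀ {x₀} → CosetMin x₀ → ∀ b k → Reduced (ρ b k) → ℓ (ρ b k ++ x₀) ≡ k + ℓ x₀
  additive-ρ {x₀} min b k r = ≤-antisym
    (subst (λ n → ℓ (ρ b k ++ x₀) ≤ n + ℓ x₀) (length-ρ b k) (ℓ-++-≤ (ρ b k) x₀))
    (subst (λ n → n + ℓ x₀ ≤ ℓ (ρ b k ++ x₀)) (length-alternating b k) (additive min (alternating b k) r))

  record Coset (x : Word) : Set where
    constructor coset
    field
      {base}  : Word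
      {first} : Bool
      {rank}  : ℕ
      minimal : CosetMin base
      reduced : Reduced (ρ first rank)
      factor  : x ~ (ρ first rank ++ base)

  decompose : ∀ x → Coset x
  decompose x with cosetMin-exists x
  ... | x₀ , v , min , p with reduceWord v
  ...   | v′ , r , q with Reduced⇒alternating v′ r
  ...     | b , e = coset min (subst (λ z → Reduced (map g z)) e r)
                          (~trans p (++-congʳ x₀ (~trans q (≡⇒~ (cong (map g) e)))))

  -- The alternating words of length k spell the longest element of the dihedral group, so k stands
  -- for m(s,t).
  record Longest (k : ℕ) : Set where
    constructor longest
    field
      reduced : ∀ b → Reduced (ρ b k)
      braid   : ∀ b → ρ b k ~ ρ (not b) k

  Longest-from : ∀ b k → Reduced (ρ b k) → ρ b k ~ ρ (not b) k → Longest k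
  Longest-from b k r p = longest
    (bool-cover (λ c → Reduced (ρ c k)) b r
      (subst₂ _≤_ (trans (length-ρ b k) (sym (length-ρ (not b) k))) (ℓ-cong p) r))
    (bool-cover (λ c → ρ c k ~ ρ (not c) k) b p
      (~trans (~sym p) (≡⇒~ (cong (λ c → ρ c k) (sym (not-involutive b))))))

  -- Exchange turns the extended word into a reduced word of length k, which is again alternating.
  -- If it ended in b, the extended word would equal ρ b k, and cancelling would make ρ b (suc k)
  -- too short, except for k = 0, where both endings coincide. So it ends in the other letter.
  braid-from-nonreduced : ∀ b k → Reduced (ρ b (suc k)) → ¬ Reduced (ρ b (suc (suc k))) → ρ b (suc k) ~ ρ (not b) (suc k)
  braid-from-nonreduced b k r ¬r with ascent-or-descent (g (letter b (suc k))) (ρ b (suc k))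
  ... | inj₁ lt = ⊥-elim (¬r (≤-trans (s≤s r) lt))
  ... | inj₂ lt with exchange (g (letter b (suc k))) (ρ b (suc k)) lt
  ...   | w , d , p with Del-map g (alternating b (suc k)) d
  ...     | v , d′ , refl = go (Reduced⇒alternating v red)
    where
    len-v : length v ≡ k
    len-v = suc-injective (trans (sym (Del-length d′)) (length-alternating b (suc k)))
    red : Reduced (map g v)
    red = ≤-pred (≤-trans (≤-reflexive (sym (Del-length d)))
            (≤-trans r (≤-trans (≤-reflexive (descent⇒suc lt)) (s≤s (≤-reflexive (ℓ-cong p))))))
    good : ρ b (suc k) ~ (g (letter b (suc k)) ∷ ρ (not b) k) → ρ b (suc k) ~ ρ (not b) (suc k)
    good q = ~trans q (≡⇒~ (ρ-flip b k))
    bad : ∀ k → Reduced (ρ b (suc k)) → ρ b (suc k) ~ (g (letter b (suc k)) ∷ ρ b k) →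
          ρ b (suc k) ~ (g (letter b (suc k)) ∷ ρ (not b) k)
    bad zero    r q = q
    bad (suc k) r q = ⊥-elim (<⇒≱ (≤-trans (n≤1+n _) r)
      (ℓ≤length (~sym (~trans q (~trans (ρ-drop b k) (cancel (g (letter b k)) (ρ b k)))))))
    go : (∃ λ c → v ≡ alternating c (length v)) → ρ b (suc k) ~ ρ (not b) (suc k)
    go (c , e) = good (bool-cover (λ c → ρ b (suc k) ~ (g (letter b (suc k)) ∷ ρ c k) → ρ b (suc k) ~ (g (letter b (suc k)) ∷ ρ (not b) k))
                        b (bad k r) (λ q → q) c q)
      where
      q : ρ b (suc k) ~ (g (letter b (suc k)) ∷ ρ c k)
      q = ~trans (~sym (cancel (g (letter b (suc k))) (ρ b (suc k))))
            (∷-cong (g (letter b (suc k)))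
              (~trans p (≡⇒~ (cong (map g) (trans e (cong (alternating c) len-v))))))

  record Top (x : Word) : Set where
    constructor top
    field
      {base}  : Word
      {rank}  : ℕ
      minimal : CosetMin base
      isLongest : Longest (suc rank)
      factor  : ∀ b → x ~ (ρ b (suc rank) ++ base)

  -- The alternating factor of x cannot be empty, as the coset minimum has no descent, and it cannot
  -- be extended to a longer reduced one, as by additivity the next letter would raise x. So it is a
  -- longest word.
  decomposeTop : ∀ {x} → (∀ b → ℓ (g b ∷ x) < ℓ x) → Top x
  decomposeTop {x} desc with decompose x
  ... | coset {x₀} {b} {zero} min r p = ⊥-elim (<⇒≱ (desc true)
          (subst₂ _≤_ (ℓ-cong (~sym p)) (ℓ-cong (∷-cong (g true) (~sym p))) (min [ true ])))
  ... | coset {x₀} {b} {suc k} min r p = top min L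
          (bool-cover (λ c → x ~ (ρ c (suc k) ++ x₀)) b p (~trans p (++-congʳ x₀ (Longest.braid L b))))
    where
    d = letter b (suc k)
    ¬red : ¬ Reduced (ρ b (suc (suc k)))
    ¬red r′ = <⇒≱ (desc d) (begin
      ℓ x                         ≡⟨ ℓ-cong p ⟩
      ℓ (ρ b (suc k) ++ x₀)       ≡⟨ additive-ρ min b (suc k) r ⟩
      suc k + ℓ x₀                ≤⟨ n≤1+n _ ⟩
      suc (suc k) + ℓ x₀          ≡⟨ additive-ρ min b (suc (suc k)) r′ ⟨
      ℓ (ρ b (suc (suc k)) ++ x₀) ≡⟨ ℓ-cong (∷-cong (g d) p) ⟨
      ℓ (g d ∷ x) ∎)
      where open ≤-Reasoning
    L : Longest (suc k)
    L = Longest-from b (suc k) r (braid-from-nonreduced b k r ¬red)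

  -- One letter beyond the longest word, the braid relation creates a cancellation and the word
  -- drops to length n.
  Reduced⇒≤ : ∀ {n} → Longest (suc n) → ∀ b k → Reduced (ρ b k) → k ≤ suc n
  Reduced⇒≤ {n} L b k r = ≮⇒≥ λ lt → <⇒≱ (≤-trans (n≤1+n _) (Reduced-ρ-≤ b lt r))
    (≤-trans (ℓ≤length (~sym shorter)) (≤-reflexive (trans (length-ρ (not b) n) (sym (length-ρ b n)))))
    where
    d = g (letter b (suc n))
    shorter : ρ b (suc (suc n)) ~ ρ (not b) n
    shorter = ~trans (∷-cong d (~trans (Longest.braid L b) (≡⇒~ (sym (ρ-flip b n))))) (cancel d _)

  -- The part of a coset inside W^H

  module _ {x₀ : Word} (x₀∈ : InWH x₀) (min : CosetMin x₀) where

    -- Reduces membership along the coset to membership of the elements r x₀. A descent h of v x₀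
    -- deletes a letter of v, not of x₀, so x₀ h = u x₀ for a word u in the two generators;
    -- additivity and ℓ (x₀ h) ≤ ℓ x₀ + 1 leave a single letter for u.
    blocking-generator : ∀ v → Reduced (map g v) → ¬ InWH (map g v ++ x₀) →
      ∃ λ c → ¬ InWH (g c ∷ x₀) × ℓ (map g v ++ g c ∷ x₀) < ℓ (map g v ++ x₀)
    blocking-generator v r ¬p with ¬InWH⇒descent ¬p | reducedWord x₀
    ... | h , hh , lt | y , y~x₀ , e with exchangeʳ h (map g v ++ y)
            (subst₂ _<_ (ℓ-cong (++-congʳ [ h ] (++-congˡ (map g v) (~sym y~x₀)))) (ℓ-cong (++-congˡ (map g v) (~sym y~x₀))) lt)
    ...   | w , d , p with Del-++ (map g v) d
    ...     | inj₂ (y′ , d′ , refl) = ⊥-elim (<-asym (InWH-ascent x₀∈ hh)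
              (≤-<-trans (ℓ≤length (~sym (~trans (++-congʳ [ h ] (~sym y~x₀))
                 (++-cancelˡ (map g v) _ _ (~trans (≡⇒~ (sym (++-assoc (map g v) y [ h ]))) p)))))
                 (≤-reflexive (trans (sym (Del-length d′)) e))))
    ...     | inj₁ (_ , d′ , refl) with Del-map g v d′
    ...       | v′ , _ , refl with reduceWord (reverse v ++ v′)
    ...         | u , red , q = single-letter u red x₀h
      where
      x₀h : (x₀ ++ [ h ]) ~ (map g u ++ x₀)
      x₀h = ~trans (solve-left v v′ (x₀ ++ [ h ]) x₀
              (~trans (≡⇒~ (sym (++-assoc (map g v) x₀ [ h ])))
              (~trans (++-congʳ [ h ] (++-congˡ (map g v) (~sym y~x₀)))
              (~trans p (++-congˡ (map g v′) y~x₀)))))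
            (++-congʳ x₀ q)
      single-letter : ∀ u → Reduced (map g u) → (x₀ ++ [ h ]) ~ (map g u ++ x₀) →
        ∃ λ c → ¬ InWH (g c ∷ x₀) × ℓ (map g v ++ g c ∷ x₀) < ℓ (map g v ++ x₀)
      single-letter [] _ q = ⊥-elim (<⇒≁ (InWH-ascent x₀∈ hh) (~sym q))
      single-letter (c ∷ []) _ q = c , InWH-~ʳ x₀∈ hh (~sym q) ,
        subst (_< ℓ (map g v ++ x₀)) (ℓ-cong (~trans (≡⇒~ (++-assoc (map g v) x₀ [ h ])) (++-congˡ (map g v) q))) lt
      single-letter (c ∷ c′ ∷ u) red q = ⊥-elim (<⇒≱ (s≤s (s≤s (m≤n+m (ℓ x₀) (length u))))
        (≤-trans (additive min (c ∷ c′ ∷ u) red) (≤-trans (≤-reflexive (ℓ-cong (~sym q))) x₀h-≤)))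
        where
        x₀h-≤ : ℓ (x₀ ++ [ h ]) ≤ suc (ℓ x₀)
        x₀h-≤ = ≤-trans (ℓ-++ x₀ [ h ]) (≤-trans (+-monoʳ-≤ (ℓ x₀) (ℓ≤length ~refl)) (≤-reflexive (+-comm (ℓ x₀) 1)))

    -- As r x₀ = x₀ h, the element equals ρ (not r) j x₀ h, and multiplying by h shortens it.
    blocked : ∀ {r} → ¬ InWH (g r ∷ x₀) → ∀ j → Reduced (ρ r (suc j)) → Reduced (ρ (not r) j) → ¬ InWH (ρ r (suc j) ++ x₀)
    blocked {r} ¬p j red red′ q with deodhar x₀∈ ¬p
    ... | h , hh , e = <⇒≱ (InWH-ascent q hh) (begin
        ℓ ((ρ r (suc j) ++ x₀) ++ [ h ])      ≡⟨ ℓ-cong (~trans (++-congʳ [ h ] eq) (++-reflection² (ρ (not r) j ++ x₀) (generator-reflection h))) ⟩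
        ℓ (ρ (not r) j ++ x₀)                 ≡⟨ additive-ρ min (not r) j red′ ⟩
        j + ℓ x₀                              ≤⟨ n≤1+n _ ⟩
        suc j + ℓ x₀                          ≡⟨ additive-ρ min r (suc j) red ⟨
        ℓ (ρ r (suc j) ++ x₀) ∎)
      where
      open ≤-Reasoning
      eq : (ρ r (suc j) ++ x₀) ~ ((ρ (not r) j ++ x₀) ++ [ h ])
      eq = ~trans (≡⇒~ (trans (cong (_++ x₀) (ρ-snoc r j)) (++-assoc (ρ (not r) j) [ g r ] x₀)))
             (~trans (++-congˡ (ρ (not r) j) e) (≡⇒~ (sym (++-assoc (ρ (not r) j) x₀ [ h ]))))

    -- Here m is `suc n`. In `chain` the surviving branch begins with `not r` next to x₀ and stops
    -- at height n: the longest word can also be written ending in r.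
    data Shape (n : ℕ) : Set where
      full   : (∀ b j → j ≤ suc n → InWH (ρ b j ++ x₀)) → Shape n
      chain  : ∀ r → ¬ InWH (g r ∷ x₀) → (∀ j → j ≤ n → InWH (ρ (not r) j ++ x₀)) →
               (∀ b → ¬ InWH (ρ b (suc n) ++ x₀)) → (∀ j → j ≤ n → ¬ InWH (ρ r (suc j) ++ x₀)) → Shape n
      single : (∀ b → ¬ InWH (g b ∷ x₀)) → (∀ b j → j ≤ n → ¬ InWH (ρ b (suc j) ++ x₀)) → Shape n

    module _ {n : ℕ} (L : Longest (suc n)) where

      private
        reduced-≤ : ∀ b j → j ≤ suc n → Reduced (ρ b j)
        reduced-≤ b j j≤ = Reduced-ρ-≤ b j≤ (Longest.reduced L b)

      blocked-≤ : ∀ r → ¬ InWH (g r ∷ x₀) → ∀ j → j ≤ n → ¬ InWH (ρ r (suc j) ++ x₀)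
      blocked-≤ r ¬p j j≤ = blocked ¬p j (reduced-≤ r (suc j) (s≤s j≤)) (reduced-≤ (not r) j (m≤n⇒m≤1+n j≤))

      -- On the branch of `not r` below the top, a blocking generator would have to be r, but
      -- inserting r before x₀ still lengthens these words.
      half-shape : ∀ r → ¬ InWH (g r ∷ x₀) → InWH (g (not r) ∷ x₀) → Shape n
      half-shape r ¬p q = chain r ¬p in-WH
        (bool-cover (λ b → ¬ InWH (ρ b (suc n) ++ x₀)) r (blocked-≤ r ¬p n ≤-refl)
          λ i → blocked-≤ r ¬p n ≤-refl (InWH-cong (++-congʳ x₀ (~sym (Longest.braid L r))) i))
        (blocked-≤ r ¬p)
        where
        ascends : ∀ j → j ≤ n → ℓ (ρ (not r) j ++ x₀) < ℓ (ρ (not r) j ++ g r ∷ x₀)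
        ascends j j≤ = subst₂ _<_ (sym (additive-ρ min (not r) j (reduced-≤ (not r) j (m≤n⇒m≤1+n j≤))))
          (trans (sym (additive-ρ min r (suc j) (reduced-≤ r (suc j) (s≤s j≤))))
                 (cong ℓ (trans (cong (_++ x₀) (ρ-snoc r j)) (++-assoc (ρ (not r) j) [ g r ] x₀))))
          ≤-refl
        in-WH : ∀ j → j ≤ n → InWH (ρ (not r) j ++ x₀)
        in-WH j j≤ with lem {InWH (ρ (not r) j ++ x₀)}
        ... | yes i = i
        ... | no ¬i with blocking-generator (alternating (not r) j) (reduced-≤ (not r) j (m≤n⇒m≤1+n j≤)) ¬i
        ...   | c , ¬c , lt = ⊥-elim (bool-cover
                  (λ c → ¬ InWH (g c ∷ x₀) → ¬ (ℓ (ρ (not r) j ++ g c ∷ x₀) < ℓ (ρ (not r) j ++ x₀))) r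
                  (λ _ lt → <-asym lt (ascends j j≤)) (λ ¬q _ → ¬q q) c ¬c lt)

      shape : Shape n
      shape with lem {InWH (g true ∷ x₀)} | lem {InWH (g false ∷ x₀)}
      ... | no ¬p | yes q = half-shape true ¬p q
      ... | yes p | no ¬q = half-shape false ¬q p
      ... | no ¬p | no ¬q = single ¬InWH-both λ b → blocked-≤ b (¬InWH-both b)
        where
        ¬InWH-both : ∀ b → ¬ InWH (g b ∷ x₀)
        ¬InWH-both true  = ¬p
        ¬InWH-both false = ¬q
      ... | yes p | yes q = full λ b j j≤ → in-WH b j (reduced-≤ b j j≤)
        where
        in-WH : ∀ b j → Reduced (ρ b j) → InWH (ρ b j ++ x₀)
        in-WH b j red with lem {InWH (ρ b j ++ x₀)}
        ... | yes i = i
        ... | no ¬i with blocking-generator (alternating b j) red ¬i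
        ...   | true  , ¬q , _ = ⊥-elim (¬q p)
        ...   | false , ¬q , _ = ⊥-elim (¬q q)

-- Orbits of two matchings and strict coherence

module Orbits (lem : ExcludedMiddle 0ℓ) (S : Set) (m : S → S → Maybe ℕ)
              (cox : IsCoxeterMatrix m) (H : S → Set) (g : Bool → S) where

  open Coxeter S m H lem
  open BruhatOrder lem S m cox H
  open Dihedral lem S m cox H g

  Λ : Bool → WH → WH
  Λ b = lamH (g b)

  Orbit : WH → WH → Set
  Orbit = Orb (Λ true) (Λ false)

  Orbit-step : ∀ b {x} y z → Orbit x y → proj₁ z ~ proj₁ (Λ b y) → Orbit x z
  Orbit-step true  y z o e = viaM o e
  Orbit-step false y z o e = viaN o e

  Orbit-resp : ∀ {x} y z → Orbit x y → proj₁ z ~ proj₁ y → Orbit x z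
  Orbit-resp y z (here p)   e = here (~trans e p)
  Orbit-resp y z (viaM o p) e = viaM o (~trans e p)
  Orbit-resp y z (viaN o p) e = viaN o (~trans e p)

  Orbit-move : ∀ b {x} y z → Orbit x y → proj₁ z ~ (g b ∷ proj₁ y) → Orbit x z
  Orbit-move b y z o e = Orbit-step b y z o (~trans e (≡⇒~ (sym (lam-moves y (InWH-cong e (proj₂ z))))))

  Orbit-induction : (P : Word → Set) → (∀ {u v} → u ~ v → P u → P v) →
    (∀ b u → InWH (g b ∷ u) → P u → P (g b ∷ u)) → ∀ {x} y → P (proj₁ x) → Orbit x y → P (proj₁ y)
  Orbit-induction P resp move {x} y Px o = go y o
    where
    one : ∀ b y → P (proj₁ y) → P (proj₁ (Λ b y))
    one b y Py with lamView (g b) y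
    ... | moves q e = subst P (sym e) (move b (proj₁ y) q Py)
    ... | stays _ e = subst P (sym e) Py
    go : ∀ y → Orbit x y → P (proj₁ y)
    go y (here e)           = resp (~sym e) Px
    go y (viaM {y = z} o e) = resp (~sym e) (one true z (go z o))
    go y (viaN {y = z} o e) = resp (~sym e) (one false z (go z o))

  fixedBy : ∀ b y → ¬ InWH (g b ∷ proj₁ y) → FixedBy (Λ true) (Λ false) y
  fixedBy true  y ¬p = inj₁ (≡⇒~ (lam-stays y ¬p))
  fixedBy false y ¬p = inj₂ (≡⇒~ (lam-stays y ¬p))

  ¬fixedBy : ∀ y → (∀ b → InWH (g b ∷ proj₁ y)) → ¬ FixedBy (Λ true) (Λ false) y
  ¬fixedBy y p (inj₁ e) = ℓ-∷-≢ _ _ (ℓ-cong (~trans (≡⇒~ (sym (lam-moves y (p true)))) e))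
  ¬fixedBy y p (inj₂ e) = ℓ-∷-≢ _ _ (ℓ-cong (~trans (≡⇒~ (sym (lam-moves y (p false)))) e))

  -- The letter c goes one step up branch b, one step down, or, at the bottom, over to the other
  -- branch.
  data Move (b : Bool) (x : Word) : ℕ → Bool → Set where
    rises : ∀ {j c} → c ≡ letter b j → Move b x j c
    falls : ∀ {j c} → (g c ∷ (ρ b (suc j) ++ x)) ~ (ρ b j ++ x) → Move b x (suc j) c
    turns : ∀ {c} → c ≡ not b → Move b x zero c

  move : ∀ b x j c → Move b x j c
  move b x j c with c Bool.≟ letter b j
  ... | yes e = rises e
  move b x zero    c | no ne = turns (¬-not ne)
  move b x (suc j) c | no ne = falls (~trans (≡⇒~ (cong (λ d → g d ∷ (ρ b (suc j) ++ x)) (trans (¬-not ne) (not-involutive _)))) (cancel (g (letter b j)) _))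

  module _ {n : ℕ} (L : Longest (suc n)) {x₀ : Word} (x₀∈ : InWH x₀) (min : CosetMin x₀) where

    private
      reduced-≤ : ∀ b j → j ≤ suc n → Reduced (ρ b j)
      reduced-≤ b j j≤ = Reduced-ρ-≤ b j≤ (Longest.reduced L b)

      base : WH
      base = x₀ , x₀∈

    ρ-ascent : ∀ b {j} → j ≤ n → ℓ (ρ b j ++ x₀) < ℓ (ρ b (suc j) ++ x₀)
    ρ-ascent b {j} j≤ = subst₂ _<_ (sym (additive-ρ min b j (reduced-≤ b j (m≤n⇒m≤1+n j≤))))
      (sym (additive-ρ min b (suc j) (reduced-≤ b (suc j) (s≤s j≤)))) ≤-refl

    ρ-mono : ∀ b {i j} → i ≤ j → j ≤ suc n → (ρ b i ++ x₀) ≤B (ρ b j ++ x₀)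
    ρ-mono b {i} {zero}  z≤n _ = br-refl ~refl
    ρ-mono b {i} {suc j} i≤ j≤ with m≤n⇒m<n∨m≡n i≤
    ... | inj₂ refl = br-refl ~refl
    ... | inj₁ i<   = ≤B-trans (ρ-mono b (≤-pred i<) (<⇒≤ j≤)) (ascent-≤B (ρ-ascent b (≤-pred j≤)))

    Branch : Bool → ℕ → Set
    Branch b N = ∀ j → j ≤ N → InWH (ρ b j ++ x₀)

    module _ {b : Bool} {N : ℕ} (N≤ : N ≤ suc n) (br : Branch b N) where

      vertex : ∀ j → j ≤ N → WH
      vertex j j≤ = ρ b j ++ x₀ , br j j≤

      descend : ∀ {x} j → j ≤ N → ∀ y → proj₁ y ~ (ρ b j ++ x₀) → Orbit x y → Orbit x base
      descend zero    _  y e o = Orbit-resp y base o (~sym e)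
      descend (suc j) j≤ y e o = descend j (<⇒≤ j≤) (vertex j (<⇒≤ j≤)) ~refl
        (Orbit-move (letter b j) y _ o (~sym (∷-swap (g (letter b j)) e)))

      climb : ∀ {x} j (j≤ : j ≤ N) → Orbit x base → Orbit x (vertex j j≤)
      climb zero    j≤ o = Orbit-resp base _ o ~refl
      climb (suc j) j≤ o = Orbit-move (letter b j) (vertex j (<⇒≤ j≤)) _ (climb j (<⇒≤ j≤) o) ~refl

      satChain : ∀ i j → i + j ≡ N → (p : InWH (ρ b i ++ x₀)) → SatChain (ρ b i ++ x₀ , p) (vertex N ≤-refl) j
      satChain i zero e p = done (≡⇒~ (cong (λ k → ρ b k ++ x₀) (trans (sym (+-identityʳ i)) e)))
      satChain i (suc j) e p = step {c = vertex (suc i) i<}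
          (⋖-length (ρ b i ++ x₀ , p) (vertex (suc i) i<) (ascent-≤B up) (ascent⇒suc up))
          (satChain (suc i) j e′ (br (suc i) i<))
        where
        e′ : suc i + j ≡ N
        e′ = trans (sym (+-suc i j)) e
        i< : suc i ≤ N
        i< = subst (suc i ≤_) e′ (m≤m+n (suc i) j)
        up : ℓ (ρ b i ++ x₀) < ℓ (ρ b (suc i) ++ x₀)
        up = ρ-ascent b (≤-pred (≤-trans i< N≤))

    -- An isolated point has rank 0 but is chain-like, whence 1. The extra clause rules this case
    -- out for an element with a descent.
    OrbitRank : WH → Set
    OrbitRank x = OrbitM (Λ true) (Λ false) x (suc n)
                ⊎ (OrbitM (Λ true) (Λ false) x 1 × (∀ b → ¬ InWH (g b ∷ proj₁ x)))

    full-orbit : (∀ b → Branch b (suc n)) → ∀ x b k → k ≤ suc n → proj₁ x ~ (ρ b k ++ x₀) → OrbitM (Λ true) (Λ false) x (suc n)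
    full-orbit br x b k k≤ e =
      base , vertex ≤-refl (br true) (suc n) ≤-refl , suc n ,
      to-base , climb ≤-refl (br true) (suc n) ≤-refl to-base ,
      bounds , satChain ≤-refl (br true) zero (suc n) refl x₀∈ ,
      -- Not chain-like, since neither generator fixes the minimum.
      inj₂ ((λ { (_ , fixed , _) → ¬fixedBy base (λ c → br c 1 (s≤s z≤n)) fixed }) , refl)
      where
      to-base : Orbit x base
      to-base = descend ≤-refl (br b) k k≤ x e (here ~refl)
      P : Word → Set
      P y = ∃₂ λ b j → j ≤ suc n × y ~ (ρ b j ++ x₀)
      closed : ∀ c u → InWH (g c ∷ u) → P u → P (g c ∷ u)
      closed c u _ (b , j , j≤ , e) with move b x₀ j c
      ... | turns refl = not b , 1 , s≤s z≤n , ∷-cong (g c) e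
      ... | falls {j′} f = b , j′ , <⇒≤ j≤ , ~trans (∷-cong (g c) e) f
      ... | rises refl with m≤n⇒m<n∨m≡n j≤
      ...   | inj₁ j<   = b , suc j , j< , ∷-cong (g c) e
      -- The top lies on both branches, so going past it means descending the other one to height n.
      ...   | inj₂ refl = not b , n , n≤1+n n , ~trans (∷-cong (g c) e)
                (∷-swap (g c) (~trans (++-congʳ x₀ (Longest.braid L b)) (≡⇒~ (cong (_++ x₀) (sym (ρ-flip b n))))))
      in-P : ∀ y → Orbit x y → P (proj₁ y)
      in-P y = Orbit-induction P (λ { p (b , j , j≤ , e) → b , j , j≤ , ~trans (~sym p) e }) closed {x} y (b , k , k≤ , e)
      to-top : ∀ b → ρ b (suc n) ~ ρ true (suc n)
      to-top true  = ~refl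
      to-top false = Longest.braid L false
      bounds : ∀ y → Orbit x y → (base ≤H y) × (proj₁ y ≤B (ρ true (suc n) ++ x₀))
      bounds y o with in-P y o
      ... | b , j , j≤ , e = ≤B-respʳ (~sym e) (ρ-mono b z≤n j≤) ,
              ≤B-respˡ e (≤B-respʳ (++-congʳ x₀ (to-top b)) (ρ-mono b j≤ ≤-refl))

    -- Stated for any height N, to cover both the chain (N = n) and the isolated point (N = 0).
    chain-orbit : ∀ b {N} → N ≤ n → Branch b N → ¬ InWH (ρ b (suc N) ++ x₀) → ¬ InWH (g (not b) ∷ x₀) →
      ∀ x k → k ≤ N → proj₁ x ~ (ρ b k ++ x₀) → OrbitM (Λ true) (Λ false) x (suc N)
    chain-orbit b {N} N≤ br ¬top ¬bottom x k k≤ e =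
      base , vertex N≤′ br N ≤-refl , N ,
      to-base , climb N≤′ br N ≤-refl to-base ,
      bounds , satChain N≤′ br zero N refl x₀∈ ,
      inj₁ ((comparable , fixedBy (not b) base ¬bottom , fixedBy (letter b N) (vertex N≤′ br N ≤-refl) ¬top) , refl)
      where
      N≤′ : N ≤ suc n
      N≤′ = m≤n⇒m≤1+n N≤
      to-base : Orbit x base
      to-base = descend N≤′ br k k≤ x e (here ~refl)
      P : Word → Set
      P y = ∃ λ j → j ≤ N × y ~ (ρ b j ++ x₀)
      closed : ∀ c u → InWH (g c ∷ u) → P u → P (g c ∷ u)
      closed c u i (j , j≤ , e) with move b x₀ j c
      ... | turns refl = ⊥-elim (¬bottom (InWH-cong (∷-cong (g c) e) i))
      ... | falls {j′} f = j′ , <⇒≤ j≤ , ~trans (∷-cong (g c) e) f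
      ... | rises refl with m≤n⇒m<n∨m≡n j≤
      ...   | inj₁ j<   = suc j , j< , ∷-cong (g c) e
      ...   | inj₂ refl = ⊥-elim (¬top (InWH-cong (∷-cong (g c) e) i))
      in-P : ∀ y → Orbit x y → P (proj₁ y)
      in-P y = Orbit-induction P (λ { p (j , j≤ , e) → j , j≤ , ~trans (~sym p) e }) closed {x} y (k , k≤ , e)
      bounds : ∀ y → Orbit x y → (base ≤H y) × (proj₁ y ≤B (ρ b N ++ x₀))
      bounds y o with in-P y o
      ... | j , j≤ , e = ≤B-respʳ (~sym e) (ρ-mono b z≤n (≤-trans j≤ N≤′)) , ≤B-respˡ e (ρ-mono b j≤ N≤′)
      comparable : IsChain (Orbit x)
      comparable y z o o′ with in-P y o | in-P z o′
      ... | i , i≤ , e | j , j≤ , f with ≤-total i j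
      ...   | inj₁ i≤j = inj₁ (≤B-respˡ e (≤B-respʳ (~sym f) (ρ-mono b i≤j (≤-trans j≤ N≤′))))
      ...   | inj₂ j≤i = inj₂ (≤B-respˡ f (≤B-respʳ (~sym e) (ρ-mono b j≤i (≤-trans i≤ N≤′))))

    orbit-rank : ∀ x b k → k ≤ suc n → proj₁ x ~ (ρ b k ++ x₀) → OrbitRank x
    orbit-rank x b k k≤ e with shape x₀∈ min L
    ... | full br = inj₁ (full-orbit br x b k k≤ e)
    ... | chain r ¬r br ¬top dead = inj₁ (bool-cover
            (λ b → ∀ k → k ≤ suc n → proj₁ x ~ (ρ b k ++ x₀) → OrbitM (Λ true) (Λ false) x (suc n)) r
            on-dead on-branch b k k≤ e)
      where
      on-branch : ∀ k → k ≤ suc n → proj₁ x ~ (ρ (not r) k ++ x₀) → OrbitM (Λ true) (Λ false) x (suc n)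
      on-branch k k≤ e with m≤n⇒m<n∨m≡n k≤
      ... | inj₁ k<   = chain-orbit (not r) ≤-refl br (¬top (not r))
              (subst (λ c → ¬ InWH (g c ∷ x₀)) (sym (not-involutive r)) ¬r) x k (≤-pred k<) e
      ... | inj₂ refl = ⊥-elim (¬top (not r) (InWH-cong e (proj₂ x)))
      on-dead : ∀ k → k ≤ suc n → proj₁ x ~ (ρ r k ++ x₀) → OrbitM (Λ true) (Λ false) x (suc n)
      on-dead zero    k≤ e = on-branch zero z≤n e
      on-dead (suc k) k≤ e = ⊥-elim (dead k (≤-pred k≤) (InWH-cong e (proj₂ x)))
    ... | single ¬g dead with k | e
    ...   | suc k′ | e′ = ⊥-elim (dead b k′ (≤-pred k≤) (InWH-cong e′ (proj₂ x)))
    ...   | zero   | e′ = inj₂ (chain-orbit b z≤n (λ { _ z≤n → x₀∈ }) (¬g b) (¬g (not b)) x zero z≤n e′ ,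
                              λ c i → ¬g c (InWH-cong (∷-cong (g c) e′) i))

  suffix-InWH : ∀ {x₀ x} → CosetMin x₀ → ∀ b k → Reduced (ρ b k) → InWH x → x ~ (ρ b k ++ x₀) → InWH x₀
  suffix-InWH min b k r p e = InWH-suffix (ρ b k)
    (≤-reflexive (trans (cong (_+ _) (length-ρ b k)) (sym (additive-ρ min b k r)))) (InWH-cong e p)

  -- The `Longest (suc n)` extracted from w governs every other coset, so each orbit has the same m
  -- as that of w or has m = 1.
  strictlyCoherent : ∀ w → (∀ b → ℓ (g b ∷ proj₁ w) < ℓ (proj₁ w)) → StrictlyCoherent w (Λ true) (Λ false)
  strictlyCoherent w desc x _ with decomposeTop desc
  ... | top {w₀} {n} min L f = combine rank-x rank-w
    where
    rank-w : OrbitM (Λ true) (Λ false) w (suc n)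
    rank-w with orbit-rank L (suffix-InWH min true (suc n) (Longest.reduced L true) (proj₂ w) (f true)) min w true (suc n) ≤-refl (f true)
    ... | inj₁ o        = o
    ... | inj₂ (_ , ¬i) = ⊥-elim (¬i true (InWH-descent (desc true) (proj₂ w)))
    rank-x : OrbitM (Λ true) (Λ false) x (suc n) ⊎ OrbitM (Λ true) (Λ false) x 1
    rank-x with decompose (proj₁ x)
    ... | coset {x₀} {b} {k} min′ red e with orbit-rank L (suffix-InWH min′ b k red (proj₂ x) e) min′ x b k (Reduced⇒≤ L b k red) e
    ...   | inj₁ o       = inj₁ o
    ...   | inj₂ (o , _) = inj₂ o
    combine : OrbitM (Λ true) (Λ false) x (suc n) ⊎ OrbitM (Λ true) (Λ false) x 1 → OrbitM (Λ true) (Λ false) w (suc n) →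
      Σ ℕ λ k → Σ ℕ λ k′ → OrbitM (Λ true) (Λ false) x k × OrbitM (Λ true) (Λ false) w k′ × (k ∣ k′)
    combine (inj₁ o) o′ = suc n , suc n , o , o′ , ∣-refl
    combine (inj₂ o) o′ = 1 , suc n , o , o′ , 1∣ suc n

-- The pircon system

module PirconSystem (lem : ExcludedMiddle 0ℓ) (S : Set) (m : S → S → Maybe ℕ)
                    (cox : IsCoxeterMatrix m) (H : S → Set) where

  open Coxeter S m H lem
  open BruhatOrder lem S m cox H

  isPirconSystem : IsPirconSystem
  isPirconSystem =
      isPircon
    , (λ i → (λ _ _ y≤ x≤y → ≤B-trans x≤y y≤) , lam-qspm (IdxH.top i) (LenLt⇒< (IdxH.desc i)))
    , (λ w ¬min → let (s , lt) = leftDescent (¬Minimal⇒≁[] w ¬min) in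
         idx w s (¬Minimal⇒≁[] w ¬min) (<⇒LenLt lt) , br-refl ~refl , lam-⋖ w lt)
    , λ i j w _ _ i⋖ j⋖ → coherent (IdxH.gen i) (IdxH.gen j) w (lam-⋖⇒descent w i⋖) (lam-⋖⇒descent w j⋖)
    where
    coherent : ∀ s t w → ℓ (s ∷ proj₁ w) < ℓ (proj₁ w) → ℓ (t ∷ proj₁ w) < ℓ (proj₁ w) → Coherent w (lamH s) (lamH t)
    -- Two descents are strictly coherent already, so a chain with one link suffices.
    coherent s t w ds dt = link (lam-spm w ds)
      (Orbits.strictlyCoherent lem S m cox H (λ b → if b then s else t) w (λ { true → ds ; false → dt }))
      (trivial (lam-spm w dt))

-- Hecke operators on functions on W^H

module Operators (lem : ExcludedMiddle 0ℓ) (S : Set) (m : S → S → Maybe ℕ)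
                 (cox : IsCoxeterMatrix m) (H : S → Set) (x : Xval) where

  open Coxeter S m H lem
  open BruhatOrder lem S m cox H

  -- Functions take arbitrary words, so that `T` can evaluate at s u without a membership proof;
  -- `_≐_` and `Resp` then look at W^H only.
  Fun : Set
  Fun = Word → V

  infix 4 _≐_
  _≐_ : Fun → Fun → Set
  f ≐ h = ∀ u → InWH u → f u ≋ h u

  ≐-sym : ∀ {f h} → f ≐ h → h ≐ f
  ≐-sym p u i = ≋-sym (p u i)

  ≐-trans : ∀ {f h k} → f ≐ h → h ≐ k → f ≐ k
  ≐-trans p q u i = ≋-trans (p u i) (q u i)

  Resp : Fun → Set
  Resp f = ∀ u u′ → InWH u → u ~ u′ → f u ≋ f u′

  -- The operator turning the column R_{·,sw} into the column R_{·,w}, for s ∈ D_L(w).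
  T : S → Fun → Fun
  T s f u with lem {ℓ (s ∷ u) < ℓ u} | lem {InWH (s ∷ u)}
  ... | yes _ | _     = f (s ∷ u)
  ... | no _  | yes _ = mix (f u) (f (s ∷ u))
  ... | no _  | no _  = c· x (f u)

  T-lowers : ∀ {s u} f → ℓ (s ∷ u) < ℓ u → T s f u ≋ f (s ∷ u)
  T-lowers {s} {u} f lt with lem {ℓ (s ∷ u) < ℓ u} | lem {InWH (s ∷ u)}
  ... | yes _  | _ = ≋-refl
  ... | no ¬lt | _ = ⊥-elim (¬lt lt)

  T-raises : ∀ {s u} f → InWH (s ∷ u) → ℓ u < ℓ (s ∷ u) → T s f u ≋ mix (f u) (f (s ∷ u))
  T-raises {s} {u} f p lt with lem {ℓ (s ∷ u) < ℓ u} | lem {InWH (s ∷ u)}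
  ... | yes gt | _     = ⊥-elim (<-asym lt gt)
  ... | no _   | yes _ = ≋-refl
  ... | no _   | no ¬p = ⊥-elim (¬p p)

  T-fixes : ∀ {s u} f → ¬ InWH (s ∷ u) → ℓ u < ℓ (s ∷ u) → T s f u ≋ c· x (f u)
  T-fixes {s} {u} f ¬p lt with lem {ℓ (s ∷ u) < ℓ u} | lem {InWH (s ∷ u)}
  ... | yes gt | _     = ⊥-elim (<-asym lt gt)
  ... | no _   | yes p = ⊥-elim (¬p p)
  ... | no _   | no _  = ≋-refl

  back-down : ∀ s {u} → ℓ u < ℓ (s ∷ u) → ℓ (s ∷ s ∷ u) < ℓ (s ∷ u)
  back-down s {u} lt = subst (_< ℓ (s ∷ u)) (ℓ-cong (~sym (cancel s u))) lt

  back-up : ∀ s {u} → ℓ (s ∷ u) < ℓ u → ℓ (s ∷ u) < ℓ (s ∷ s ∷ u)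
  back-up s {u} lt = subst (ℓ (s ∷ u) <_) (ℓ-cong (~sym (cancel s u))) lt

  T-above : ∀ {s u f} → Resp f → InWH u → ℓ u < ℓ (s ∷ u) → T s f (s ∷ u) ≋ f u
  T-above {s} {u} {f} r i lt = ≋-trans (T-lowers f (back-down s lt)) (≋-sym (r _ _ i (~sym (cancel s u))))

  T-cong : ∀ s {f h} → f ≐ h → T s f ≐ T s h
  T-cong s {f} {h} p u i with position s i
  ... | raises q lt = ≋-trans (T-raises f q lt) (≋-trans (mix-cong (p u i) (p _ q)) (≋-sym (T-raises h q lt)))
  ... | lowers q lt = ≋-trans (T-lowers f lt) (≋-trans (p _ q) (≋-sym (T-lowers h lt)))
  ... | fixes ¬q lt = ≋-trans (T-fixes f ¬q lt) (≋-trans (c·-cong x (p u i)) (≋-sym (T-fixes h ¬q lt)))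

  T-resp : ∀ s {f} → Resp f → Resp (T s f)
  T-resp s {f} r u u′ i e with position s i
  ... | raises q lt = ≋-trans (T-raises f q lt) (≋-trans (mix-cong (r u u′ i e) (r _ _ q (∷-cong s e)))
          (≋-sym (T-raises f (InWH-cong (∷-cong s e) q) (subst₂ _<_ (ℓ-cong e) (ℓ-cong (∷-cong s e)) lt))))
  ... | lowers q lt = ≋-trans (T-lowers f lt) (≋-trans (r _ _ q (∷-cong s e))
          (≋-sym (T-lowers f (subst₂ _<_ (ℓ-cong (∷-cong s e)) (ℓ-cong e) lt))))
  ... | fixes ¬q lt = ≋-trans (T-fixes f ¬q lt) (≋-trans (c·-cong x (r u u′ i e))
          (≋-sym (T-fixes f (λ q → ¬q (InWH-cong (∷-cong s (~sym e)) q)) (subst₂ _<_ (ℓ-cong e) (ℓ-cong (∷-cong s e)) lt))))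

  Mix : Fun → Fun → Fun
  Mix f h u = mix (f u) (h u)

  Scale : Fun → Fun
  Scale f u = c· x (f u)

  -- The instance of ℤ[q]-linearity needed to apply the quadratic relation underneath further
  -- operators.
  T-Mix : ∀ s f h → T s (Mix f h) ≐ Mix (T s f) (T s h)
  T-Mix s f h u i with position s i
  ... | raises q lt = ≋-trans (T-raises (Mix f h) q lt) (≋-trans (mix-mix (f u) (h u) (f (s ∷ u)) (h (s ∷ u)))
          (≋-sym (mix-cong (T-raises f q lt) (T-raises h q lt))))
  ... | lowers q lt = ≋-trans (T-lowers (Mix f h) lt) (≋-sym (mix-cong (T-lowers f lt) (T-lowers h lt)))
  ... | fixes ¬q lt = ≋-trans (T-fixes (Mix f h) ¬q lt) (≋-trans (c·-mix x (f u) (h u))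
          (≋-sym (mix-cong (T-fixes f ¬q lt) (T-fixes h ¬q lt))))

  T-Scale : ∀ s f → T s (Scale f) ≐ Scale (T s f)
  T-Scale s f u i with position s i
  ... | raises q lt = ≋-trans (T-raises (Scale f) q lt) (≋-trans (≋-sym (c·-mix x (f u) (f (s ∷ u))))
          (≋-sym (c·-cong x (T-raises f q lt))))
  ... | lowers q lt = ≋-trans (T-lowers (Scale f) lt) (≋-sym (c·-cong x (T-lowers f lt)))
  ... | fixes ¬q lt = ≋-trans (T-fixes (Scale f) ¬q lt) (≋-sym (c·-cong x (T-fixes f ¬q lt)))

  -- On a pair u < s u the operator is a 2 by 2 matrix with trace q - 1 and determinant -q; at a
  -- fixed point it is a scalar root of the same quadratic.
  T-quadratic : ∀ s {f} → Resp f → T s (T s f) ≐ Mix (T s f) f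
  T-quadratic s {f} r u i with position s i
  ... | raises q lt = ≋-trans (T-raises (T s f) q lt) (mix-cong ≋-refl (T-above r i lt))
  ... | lowers q lt = ≋-trans (T-lowers (T s f) lt) (≋-trans (T-raises f (InWH-cong (~sym (cancel s u)) i) (back-up s lt))
          (mix-cong (≋-sym (T-lowers f lt)) (≋-sym (r _ _ i (~sym (cancel s u))))))
  ... | fixes ¬q lt = ≋-trans (T-fixes (T s f) ¬q lt) (≋-trans (c·-cong x (T-fixes f ¬q lt))
          (≋-trans (c·-quadratic x (f u)) (mix-cong (≋-sym (T-fixes f ¬q lt)) ≋-refl)))

  Tw : Word → Fun → Fun
  Tw []      f = f
  Tw (s ∷ v) f = T s (Tw v f)

  Tw-++ : ∀ u v f → Tw (u ++ v) f ≡ Tw u (Tw v f)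
  Tw-++ []      v f = refl
  Tw-++ (s ∷ u) v f = cong (T s) (Tw-++ u v f)

  Tw-cong : ∀ v {f h} → f ≐ h → Tw v f ≐ Tw v h
  Tw-cong []      p = p
  Tw-cong (s ∷ v) p = T-cong s (Tw-cong v p)

  Tw-resp : ∀ v {f} → Resp f → Resp (Tw v f)
  Tw-resp []      r = r
  Tw-resp (s ∷ v) r = T-resp s (Tw-resp v r)

  Tw-Mix : ∀ v f h → Tw v (Mix f h) ≐ Mix (Tw v f) (Tw v h)
  Tw-Mix []      f h u i = ≋-refl
  Tw-Mix (s ∷ v) f h = ≐-trans (T-cong s (Tw-Mix v f h)) (T-Mix s (Tw v f) (Tw v h))

  Tw-Scale : ∀ v f → Tw v (Scale f) ≐ Scale (Tw v f)
  Tw-Scale []      f u i = ≋-refl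
  Tw-Scale (s ∷ v) f = ≐-trans (T-cong s (Tw-Scale v f)) (T-Scale s (Tw v f))

-- Braid relations

module Braid (lem : ExcludedMiddle 0ℓ) (S : Set) (m : S → S → Maybe ℕ)
             (cox : IsCoxeterMatrix m) (H : S → Set) (x : Xval) (g : Bool → S) where

  open Coxeter S m H lem
  open BruhatOrder lem S m cox H
  open Dihedral lem S m cox H g
  open Orbits lem S m cox H g using (Branch; ρ-ascent; suffix-InWH)
  open Operators lem S m cox H x

  letter-onto : ∀ c k → ∃ λ b → letter b k ≡ c
  letter-onto c k with letter true k Bool.≟ c
  ... | yes e = true , e
  ... | no ne = false , trans (letter-not true k) (sym (¬-not λ e → ne (sym e)))

  module _ {n : ℕ} (L : Longest (suc n)) where

    BraidAt : Word → Set
    BraidAt u = ∀ b f → Resp f → Tw (ρ b (suc n)) f u ≋ Tw (ρ (not b) (suc n)) f u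

    BraidAt-resp : ∀ {u u′} → InWH u → u ~ u′ → BraidAt u → BraidAt u′
    BraidAt-resp i e B b f r = ≋-trans (≋-sym (Tw-resp (ρ b (suc n)) r _ _ i e))
      (≋-trans (B b f r) (Tw-resp (ρ (not b) (suc n)) r _ _ i e))

    BraidAt-from : ∀ {u} b → (∀ f → Resp f → Tw (ρ b (suc n)) f u ≋ Tw (ρ (not b) (suc n)) f u) → BraidAt u
    BraidAt-from {u} b p = bool-cover (λ b → ∀ f → Resp f → Tw (ρ b (suc n)) f u ≋ Tw (ρ (not b) (suc n)) f u) b p
      λ f r → subst (λ c → Tw (ρ (not b) (suc n)) f u ≋ Tw (ρ c (suc n)) f u) (sym (not-involutive b)) (≋-sym (p f r))

    -- With a the letter extending ρ b to the left, both sides at u are values at a u of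
    -- T a ∘ Tw (ρ b) = Tw (ρ (not b)) ∘ T (g b) and T a ∘ Tw (ρ (not b)); the quadratic
    -- relation brings these to the same shape.
    BraidAt-below : ∀ {u} c → InWH u → InWH (g c ∷ u) → ℓ u < ℓ (g c ∷ u) → BraidAt (g c ∷ u) → BraidAt u
    BraidAt-below {u} c i i′ lt B with letter-onto c (suc n)
    ... | b , refl = BraidAt-from b λ f r → ≋-trans (left f r) (≋-trans (mix-cong (B b f r) ≋-refl) (≋-sym (right f r)))
      where
      a = g (letter b (suc n))
      Z : Fun → Fun
      Z = Tw (ρ (not b) n)
      X = Tw (ρ b (suc n))
      Y = Tw (ρ (not b) (suc n))
      X≡ : ∀ f → X f ≡ Z (T (g b) f)
      X≡ f = trans (cong (λ v → Tw v f) (ρ-snoc b n)) (Tw-++ (ρ (not b) n) [ g b ] f)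
      aX≡ : ∀ f → T a (X f) ≡ Y (T (g b) f)
      aX≡ f = trans (cong (T a) (X≡ f)) (cong (λ v → Tw v (T (g b) f)) (ρ-flip b n))
      aZ≡ : ∀ f → T a (Z f) ≡ Y f
      aZ≡ f = cong (λ v → Tw v f) (ρ-flip b n)
      left : ∀ f → Resp f → X f u ≋ mix (X f (a ∷ u)) (Z f (a ∷ u))
      left f r = ≋-trans (≋-sym (T-above (Tw-resp (ρ b (suc n)) r) i lt))
        (≋-trans (λ k → cong (λ h → h (a ∷ u) k) (aX≡ f))
        (≋-trans (≋-sym (B b (T (g b) f) (T-resp (g b) r)))
        (≋-trans (λ k → cong (λ h → h (a ∷ u) k) (X≡ (T (g b) f)))
        (≋-trans (Tw-cong (ρ (not b) n) (T-quadratic (g b) r) _ i′)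
        (≋-trans (Tw-Mix (ρ (not b) n) (T (g b) f) f _ i′)
        (mix-cong (λ k → cong (λ h → h (a ∷ u) k) (sym (X≡ f))) ≋-refl))))))
      right : ∀ f → Resp f → Y f u ≋ mix (Y f (a ∷ u)) (Z f (a ∷ u))
      right f r = ≋-trans (≋-sym (T-above (Tw-resp (ρ (not b) (suc n)) r) i lt))
        (≋-trans (λ k → cong (λ h → T a h (a ∷ u) k) (sym (aZ≡ f)))
        (≋-trans (T-quadratic a (Tw-resp (ρ (not b) n) r) _ i′)
        (mix-cong (λ k → cong (λ h → h (a ∷ u) k) (aZ≡ f)) ≋-refl)))

    module _ {x₀ : Word} (x₀∈ : InWH x₀) (min : CosetMin x₀) where

      -- Descends from height N; i counts the steps back up to it.
      BraidAt-branch : ∀ b {N} → N ≤ suc n → Branch L x₀∈ min b N → BraidAt (ρ b N ++ x₀) →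
        ∀ i j → j + i ≡ N → BraidAt (ρ b j ++ x₀)
      BraidAt-branch b N≤ br B zero j e = subst (λ k → BraidAt (ρ b k ++ x₀)) (sym (trans (sym (+-identityʳ j)) e)) B
      BraidAt-branch b {N} N≤ br B (suc i) j e =
        BraidAt-below (letter b j) (br j (<⇒≤ j<)) (br (suc j) j<)
          (ρ-ascent L x₀∈ min b (≤-pred (≤-trans j< N≤)))
          (BraidAt-branch b N≤ br B i (suc j) e′)
        where
        e′ : suc j + i ≡ N
        e′ = trans (sym (+-suc j i)) e
        j< : suc j ≤ N
        j< = subst (suc j ≤_) e′ (m≤m+n (suc j) i)

      -- Each operator meets a descent and strips its own letter from the argument.
      Tw-top : ∀ b {N} → N ≤ suc n → Branch L x₀∈ min b N → ∀ f → Resp f → ∀ j → j ≤ N → Tw (ρ b j) f (ρ b j ++ x₀) ≋ f x₀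
      Tw-top b N≤ br f r zero    _  = ≋-refl
      Tw-top b N≤ br f r (suc j) j≤ = ≋-trans
        (T-above (Tw-resp (ρ b j) r) (br j (<⇒≤ j≤)) (ρ-ascent L x₀∈ min b (≤-pred (≤-trans j≤ N≤))))
        (Tw-top b N≤ br f r j (<⇒≤ j≤))

      full-top : (∀ b → Branch L x₀∈ min b (suc n)) → ∀ b → BraidAt (ρ b (suc n) ++ x₀)
      full-top br b = BraidAt-from b λ f r → ≋-trans (Tw-top b ≤-refl (br b) f r (suc n) ≤-refl)
        (≋-sym (≋-trans (Tw-resp (ρ (not b) (suc n)) r _ _ (br b (suc n) ≤-refl) (++-congʳ x₀ (Longest.braid L b)))
                        (Tw-top (not b) ≤-refl (br (not b)) f r (suc n) ≤-refl)))

      -- Both sides give (q - 1 - x) f(x₀): in one word the rightmost letter r acts as a scalar at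
      -- x₀, in the other the leftmost letter acts as a scalar at the top of the chain.
      chain-top : ∀ r → ¬ InWH (g r ∷ x₀) → Branch L x₀∈ min (not r) n → ¬ InWH (ρ (not r) (suc n) ++ x₀) →
        BraidAt (ρ (not r) n ++ x₀)
      chain-top r ¬r br ¬top = BraidAt-from r λ f rf → ≋-trans
        (λ k → cong (λ h → h (ρ (not r) n ++ x₀) k)
          (trans (cong (λ v → Tw v f) (ρ-snoc r n)) (Tw-++ (ρ (not r) n) [ g r ] f)))
        (≋-trans (Tw-top (not r) n≤ br (T (g r) f) (T-resp (g r) rf) n ≤-refl)
        (≋-trans (T-fixes f ¬r (stays⇒ascent x₀∈ ¬r))
        (≋-sym (≋-trans (T-fixes (Tw (ρ (not r) n) f) ¬top (ρ-ascent L x₀∈ min (not r) ≤-refl))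
                        (c·-cong x (Tw-top (not r) n≤ br f rf n ≤-refl))))))
        where
        n≤ : n ≤ suc n
        n≤ = n≤1+n n

      -- Every letter acts at x₀ as the scalar q - 1 - x, so only their number counts.
      Tw-single : (∀ b → ¬ InWH (g b ∷ x₀)) → ∀ b b′ j f → Tw (ρ b j) f x₀ ≋ Tw (ρ b′ j) f x₀
      Tw-single ¬g b b′ zero    f = ≋-refl
      Tw-single ¬g b b′ (suc j) f = ≋-trans (T-fixes (Tw (ρ b j) f) (¬g _) (stays⇒ascent x₀∈ (¬g _)))
        (≋-trans (c·-cong x (Tw-single ¬g b b′ j f))
                 (≋-sym (T-fixes (Tw (ρ b′ j) f) (¬g _) (stays⇒ascent x₀∈ (¬g _)))))

      braid-coset : ∀ b k → k ≤ suc n → InWH (ρ b k ++ x₀) → BraidAt (ρ b k ++ x₀)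
      braid-coset b k k≤ i with shape x₀∈ min L
      ... | full br = BraidAt-branch b ≤-refl (br b) (full-top br b) _ k (m+[n∸m]≡n k≤)
      ... | chain r ¬r br ¬top dead = bool-cover
              (λ b → ∀ k → k ≤ suc n → InWH (ρ b k ++ x₀) → BraidAt (ρ b k ++ x₀)) r on-dead on-branch b k k≤ i
        where
        on-branch : ∀ k → k ≤ suc n → InWH (ρ (not r) k ++ x₀) → BraidAt (ρ (not r) k ++ x₀)
        on-branch k k≤ i with m≤n⇒m<n∨m≡n k≤
        ... | inj₁ k<   = BraidAt-branch (not r) (n≤1+n n) br (chain-top r ¬r br (¬top (not r))) _ k (m+[n∸m]≡n (≤-pred k<))
        ... | inj₂ refl = ⊥-elim (¬top (not r) i)
        on-dead : ∀ k → k ≤ suc n → InWH (ρ r k ++ x₀) → BraidAt (ρ r k ++ x₀)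
        on-dead zero    k≤ i = on-branch zero z≤n i
        on-dead (suc k) k≤ i = ⊥-elim (dead k (≤-pred k≤) i)
      ... | single ¬g dead with k
      ...   | zero   = λ b f r → Tw-single ¬g b (not b) (suc n) f
      ...   | suc k′ = ⊥-elim (dead b k′ (≤-pred k≤) i)

    braid : ∀ b {f} → Resp f → Tw (ρ b (suc n)) f ≐ Tw (ρ (not b) (suc n)) f
    braid b {f} r u i with decompose u
    ... | coset {x₀} {b′} {k} min red e =
      BraidAt-resp (InWH-cong e i) (~sym e)
        (braid-coset (suffix-InWH min b′ k red i e) min b′ k (Reduced⇒≤ L b′ k red) (InWH-cong e i)) b f r

-- R-polynomials: independence of the chosen descent

module RPolynomials (lem : ExcludedMiddle 0ℓ) (S : Set) (m : S → S → Maybe ℕ)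
                    (cox : IsCoxeterMatrix m) (H : S → Set) (x : Xval) where

  open Coxeter S m H lem
  open BruhatOrder lem S m cox H
  open Operators lem S m cox H x

  module _ (ch : Choice) (R : WH → WH → Poly) (fam : IsRFamily x ch R) where

    open IsRFamily fam

    -- Extended by 0 outside W^H, so that vanishing off the ideal of w holds for all words.
    column : WH → Fun
    column w u with lem {InWH u}
    ... | yes p = coeff (R (u , p) w)
    ... | no _  = 0V

    column-≋ : ∀ w v → column w (proj₁ v) ≋ coeff (R v w)
    column-≋ w v@(u , p) with lem {InWH u}
    ... | yes p′ = resp (u , p′) v w w ~refl ~refl
    ... | no ¬p  = ⊥-elim (¬p p)

    column-resp : ∀ w → Resp (column w)
    column-resp w u u′ i e = ≋-trans (column-≋ w (u , i))
      (≋-trans (resp (u , i) (u′ , InWH-cong e i) w w e ~refl) (≋-sym (column-≋ w (u′ , InWH-cong e i))))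

    column-cong : ∀ {w w′} → proj₁ w ~ proj₁ w′ → column w ≐ column w′
    column-cong {w} {w′} e u i = ≋-trans (column-≋ w (u , i))
      (≋-trans (resp (u , i) (u , i) w w′ ~refl e) (≋-sym (column-≋ w′ (u , i))))

    column-0 : ∀ w u → ¬ (u ≤B proj₁ w) → column w u ≋ 0V
    column-0 w u ¬le with lem {InWH u}
    ... | yes p = notLe (u , p) w ¬le
    ... | no _  = ≋-refl

    -- The defining clauses speak of u ≤ w only. For other u both sides vanish: by lifting s u is
    -- not below w either, so neither u nor s u lies below s w.
    column-chosen : ∀ w (nm : ¬ Minimal w) → let s = IdxH.gen (proj₁ (ch w nm)) in
      ℓ (s ∷ proj₁ w) < ℓ (proj₁ w) × (∀ w′ → proj₁ w′ ~ (s ∷ proj₁ w) → column w ≐ T s (column w′))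
    column-chosen w nm = desc , recursion
      where
      s = IdxH.gen (proj₁ (ch w nm))
      desc : ℓ (s ∷ proj₁ w) < ℓ (proj₁ w)
      desc = lam-⋖⇒descent w (proj₂ (proj₂ (ch w nm)))
      recursion : ∀ w′ → proj₁ w′ ~ (s ∷ proj₁ w) → column w ≐ T s (column w′)
      recursion w′ e u i = go (lem {u ≤B proj₁ w}) (position s i)
        where
        at : ∀ v {y} → proj₁ v ≡ y → coeff (R v (lamH s w)) ≋ column w′ y
        at v refl = ≋-trans (resp v v _ w′ ~refl (~trans (≡⇒~ (lam-moves w (InWH-descent desc (proj₂ w)))) (~sym e)))
          (≋-sym (column-≋ w′ v))
        v = (u , i)
        Mv = lamH s v
        Mw = lamH s w
        w′≤w : ∀ {v} → v ≤B proj₁ w′ → v ≤B proj₁ w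
        w′≤w p = ≤B-trans (≤B-respʳ e p) (descent-≤B desc)
        go : Dec (u ≤B proj₁ w) → Position s u → column w u ≋ T s (column w′) u
        go (yes le) (lowers q lt) = ≋-trans (column-≋ w v) (≋-trans (down w nm v le (lam-⋖ v lt))
          (≋-trans (at Mv (lam-moves v q)) (≋-sym (T-lowers (column w′) lt))))
        go (yes le) (raises q lt) = ≋-trans (column-≋ w v) (≋-trans (up w nm v le (lam-⋗ v q lt))
          (≋-trans (coeff-mix (R v Mw) (R Mv Mw))
          (≋-trans (mix-cong (at v refl) (at Mv (lam-moves v q))) (≋-sym (T-raises (column w′) q lt)))))
        go (yes le) (fixes ¬q lt) = ≋-trans (column-≋ w v) (≋-trans (fixed w nm v le (≡⇒~ (lam-stays v ¬q)))
          (≋-trans (coeff-fixFactor x (R v Mw))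
          (≋-trans (c·-cong x (at v refl)) (≋-sym (T-fixes (column w′) ¬q lt)))))
        go (no ¬le) pos = ≋-trans (column-0 w u ¬le) (≋-sym (zeros pos))
          where
          at-u : column w′ u ≋ 0V
          at-u = column-0 w′ u λ p → ¬le (w′≤w p)
          at-su : column w′ (s ∷ u) ≋ 0V
          at-su = column-0 w′ (s ∷ u) λ p → ¬le (≤B-respˡ (~sym (cancel s u)) (lift-top-descent desc (w′≤w p)))
          zeros : Position s u → T s (column w′) u ≋ 0V
          zeros (lowers q lt) = ≋-trans (T-lowers (column w′) lt) at-su
          zeros (raises q lt) = ≋-trans (T-raises (column w′) q lt) (≋-trans (mix-cong at-u at-su) mix-0)
          zeros (fixes ¬q lt) = ≋-trans (T-fixes (column w′) ¬q lt) (≋-trans (c·-cong x at-u) (c·-0 x))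

    Recursion : WH → Set
    Recursion w = ∀ s → ℓ (s ∷ proj₁ w) < ℓ (proj₁ w) → ∀ w′ → proj₁ w′ ~ (s ∷ proj₁ w) → column w ≐ T s (column w′)

    -- Along a length-additive factorisation every leading letter is a descent, so the recursion
    -- strips v letter by letter.
    column-Tw : ∀ v {x₀} (x₀∈ : InWH x₀) w → proj₁ w ~ (v ++ x₀) → length v + ℓ x₀ ≤ ℓ (v ++ x₀) →
      (∀ w′ → ℓ (proj₁ w′) ≤ ℓ (proj₁ w) → Recursion w′) → column w ≐ Tw v (column (x₀ , x₀∈))
    column-Tw []      x₀∈ w e add rec = column-cong e
    column-Tw (s ∷ v) {x₀} x₀∈ w e add rec = ≐-trans (rec w ≤-refl s desc w′ (~sym sw))
      (T-cong s (column-Tw v x₀∈ w′ ~refl add′ λ w″ le → rec w″ (≤-trans le (<⇒≤ lt))))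
      where
      sw : (s ∷ proj₁ w) ~ (v ++ x₀)
      sw = ∷-swap s e
      add′ : length v + ℓ x₀ ≤ ℓ (v ++ x₀)
      add′ = ≤-pred (≤-trans add (ℓ-∷-≤ s (v ++ x₀)))
      lt : ℓ (v ++ x₀) < ℓ (proj₁ w)
      lt = ≤-trans (s≤s (ℓ-++-≤ v x₀)) (≤-trans add (≤-reflexive (ℓ-cong (~sym e))))
      desc : ℓ (s ∷ proj₁ w) < ℓ (proj₁ w)
      desc = subst (_< ℓ (proj₁ w)) (ℓ-cong (~sym sw)) lt
      w′ : WH
      w′ = v ++ x₀ , InWH-cong sw (InWH-descent desc (proj₂ w))

    private
      pair : S → S → Bool → S
      pair s t b = if b then s else t

    -- The recursion holds for the chosen descent t. By induction the columns of t w and s w unfold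
    -- to the column of x₀ along the two alternating words of length n, and `braid` identifies the
    -- results.
    recursion-step : ∀ w → (∀ w′ → ℓ (proj₁ w′) < ℓ (proj₁ w) → Recursion w′) → Recursion w
    recursion-step w ih s ds w′ e = main (decomposeTop {proj₁ w} (λ { true → ds ; false → dt }))
      where
      nm : ¬ Minimal w
      nm = ≁[]⇒¬Minimal w λ p → n≮0 (subst (ℓ (s ∷ proj₁ w) <_) (trans (ℓ-cong p) ℓ[]≡0) ds)
      t : S
      t = IdxH.gen (proj₁ (ch w nm))
      dt : ℓ (t ∷ proj₁ w) < ℓ (proj₁ w)
      dt = proj₁ (column-chosen w nm)
      open Dihedral lem S m cox H (pair s t)
      open Orbits lem S m cox H (pair s t) using (suffix-InWH)
      open Braid lem S m cox H x (pair s t) using (braid; letter-onto)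
      main : Top (proj₁ w) → column w ≐ T s (column w′)
      -- The letter b is chosen so that the longest word ending in b starts with s; the one ending
      -- in `not b` then starts with t.
      main (top {x₀} {n} min L f) with letter-onto true n
      ... | b , eb = ≐-trans (proj₂ (column-chosen w nm) (tw , tw∈) ~refl)
                    (≐-trans (unfold (not b) t et (tw , tw∈) ~refl)
                    (≐-trans (≐-sym (braid L b (column-resp (x₀ , x₀∈))))
                    (≐-sym (unfold b s es w′ e))))
        where
        tw = t ∷ proj₁ w
        tw∈ : InWH tw
        tw∈ = InWH-descent dt (proj₂ w)
        x₀∈ : InWH x₀
        x₀∈ = suffix-InWH min true (suc n) (Longest.reduced L true) (proj₂ w) (f true)
        es : pair s t (letter b n) ≡ s
        es = cong (pair s t) eb
        et : pair s t (letter (not b) n) ≡ t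
        et = cong (pair s t) (trans (letter-not b n) (cong not eb))
        unfold : ∀ b r → pair s t (letter b n) ≡ r → ∀ w′ → proj₁ w′ ~ (r ∷ proj₁ w) →
          T r (column w′) ≐ Tw (ρ b (suc n)) (column (x₀ , x₀∈))
        unfold b r refl w′ e = T-cong r (column-Tw (ρ b n) x₀∈ w′ e′ add λ w″ le → ih w″ (≤-<-trans le lt))
          where
          red : Reduced (ρ b n)
          red = Reduced-tail (Longest.reduced L b)
          e′ : proj₁ w′ ~ (ρ b n ++ x₀)
          e′ = ~trans e (∷-swap r (f b))
          add : length (ρ b n) + ℓ x₀ ≤ ℓ (ρ b n ++ x₀)
          add = ≤-reflexive (trans (cong (_+ ℓ x₀) (length-ρ b n)) (sym (additive-ρ min b n red)))
          lt : ℓ (proj₁ w′) < ℓ (proj₁ w)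
          lt = subst₂ _<_ (sym (trans (ℓ-cong e′) (additive-ρ min b n red)))
                 (sym (trans (ℓ-cong (f b)) (additive-ρ min b (suc n) (Longest.reduced L b)))) ≤-refl

    recursion : ∀ w → Recursion w
    recursion w = <-rec (λ k → ∀ w → ℓ (proj₁ w) ≡ k → Recursion w)
      (λ { k ih w refl → recursion-step w λ w′ lt → ih lt w′ refl }) (ℓ (proj₁ w)) w refl

    -- Eigenvectors: generators with s w outside W^H

    Eigen : WH → Set
    Eigen w = ∀ s → ¬ InWH (s ∷ proj₁ w) → T s (column w) ≐ Scale (column w)

    -- The column is supported at e. As s is not in W^H, a point u moved by s inside W^H has neither
    -- u = e nor s u = e, so both sides vanish there.
    eigen-identity : ∀ w → proj₁ w ~ [] → Eigen w
    eigen-identity w w~[] s ¬sw u i = go (position s i)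
      where
      vanish : ∀ {v} → ¬ (v ~ proj₁ w) → column w v ≋ 0V
      vanish {v} ne = column-0 w v λ le → ne (≤B-antisym le (≤B-respˡ w~[] ([]-≤B v)))
      vanish-< : ∀ {v v′} → ℓ v < ℓ v′ → column w v′ ≋ 0V
      vanish-< {v} lt = vanish λ p → n≮0 (subst (ℓ v <_) (trans (ℓ-cong p) (trans (ℓ-cong w~[]) ℓ[]≡0)) lt)
      scale-0 : column w u ≋ 0V → 0V ≋ c· x (column w u)
      scale-0 z = ≋-sym (≋-trans (c·-cong x z) (c·-0 x))
      go : Position s u → T s (column w) u ≋ c· x (column w u)
      go (fixes ¬q lt) = T-fixes (column w) ¬q lt
      go (lowers q lt) = ≋-trans (T-lowers (column w) lt)
        (≋-trans (vanish λ p → ¬sw (InWH-cong (~sym (∷-swap s (~sym p))) i)) (scale-0 (vanish-< lt)))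
      go (raises q lt) = ≋-trans (T-raises (column w) q lt)
        (≋-trans (mix-cong at-u (vanish-< lt)) (≋-trans mix-0 (scale-0 at-u)))
        where
        at-u : column w u ≋ 0V
        at-u = vanish λ p → ¬sw (InWH-cong (∷-cong s p) q)

    -- If s w = w h, then s w has the dihedral factorisation in which h emerges at the
    -- minimal coset representative x₀, so the braid relation moves T s across to T r on column x₀.
    eigen-step : ∀ w → (∀ w′ → ℓ (proj₁ w′) < ℓ (proj₁ w) → Eigen w′) → Eigen w
    eigen-step w ih s ¬sw with lem {proj₁ w ~ []}
    ... | yes p = eigen-identity w p s ¬sw
    ... | no ¬p with leftDescent ¬p | deodhar (proj₂ w) ¬sw
    ...   | t , dt | h , hh , swh = main (decomposeTop {z} (λ { true → ds ; false → dtz }))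
      where
      z = s ∷ proj₁ w
      up-s : ℓ (proj₁ w) < ℓ z
      up-s = stays⇒ascent (proj₂ w) ¬sw
      ds : ℓ (s ∷ z) < ℓ z
      ds = back-down s up-s
      -- With z = s w = w h, the length of t z = t w h is at most ℓ (t w) + 1 ≤ ℓ w < ℓ z.
      dtz : ℓ (t ∷ z) < ℓ z
      dtz = ≤-<-trans (≤-trans (≤-reflexive (ℓ-cong (∷-cong t swh)))
        (≤-trans (ℓ-++ (t ∷ proj₁ w) [ h ]) (≤-trans (+-monoʳ-≤ (ℓ (t ∷ proj₁ w)) (ℓ≤length ~refl))
          (≤-trans (≤-reflexive (+-comm _ 1)) dt)))) up-s
      open Dihedral lem S m cox H (pair s t)
      open Orbits lem S m cox H (pair s t) using (suffix-InWH)
      open Braid lem S m cox H x (pair s t) using (braid; letter-onto)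
      main : Top z → T s (column w) ≐ Scale (column w)
      main (top {x₀} {n} min L f) with letter-onto true n
      ... | b , eb = finish (n≢0 n w-factor) (shape x₀∈ min L)
        where
        es : pair s t (letter b n) ≡ s
        es = cong (pair s t) eb
        red : Reduced (ρ b n)
        red = Reduced-tail (Longest.reduced L b)
        w-factor : proj₁ w ~ (ρ b n ++ x₀)
        w-factor = ∷-cancel s (~trans (f b) (≡⇒~ (cong (λ r → r ∷ (ρ b n ++ x₀)) es)))
        x₀∈ : InWH x₀
        x₀∈ = suffix-InWH min b n red (proj₂ w) w-factor
        n≢0 : ∀ k → proj₁ w ~ (ρ b k ++ x₀) → k ≢ 0
        n≢0 zero e _ = <⇒≱ dt (subst₂ _≤_ (ℓ-cong (~sym e)) (ℓ-cong (∷-cong t (~sym e))) (min [ false ]))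
        col₀ = column (x₀ , x₀∈)
        col-w : column w ≐ Tw (ρ b n) col₀
        col-w = column-Tw (ρ b n) x₀∈ w w-factor
          (≤-reflexive (trans (cong (_+ ℓ x₀) (length-ρ b n)) (sym (additive-ρ min b n red)))) (λ w′ _ → recursion w′)
        dead-end : n ≢ 0 → (∀ j → j ≤ n → ¬ InWH (ρ b (suc j) ++ x₀)) → T s (column w) ≐ Scale (column w)
        dead-end ne dead = ⊥-elim (contra n ne w-factor dead)
          where
          contra : ∀ k → k ≢ 0 → proj₁ w ~ (ρ b k ++ x₀) → (∀ j → j ≤ k → ¬ InWH (ρ b (suc j) ++ x₀)) → ⊥
          contra zero    ne _ _    = ne refl
          contra (suc k) _  e dead = dead k (n≤1+n k) (InWH-cong e (proj₂ w))
        transport : n ≢ 0 → ¬ InWH (pair s t (not b) ∷ x₀) → T s (column w) ≐ Scale (column w)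
        transport ne ¬r = ≐-trans (T-cong s col-w)
          (≐-trans (subst (λ r → T r (Tw (ρ b n) col₀) ≐ Tw (ρ (not b) (suc n)) col₀) es (braid L b (column-resp (x₀ , x₀∈))))
          (≐-trans (subst (λ h → Tw (ρ (not b) (suc n)) col₀ ≐ h) Y≡ (λ u i → ≋-refl))
          (≐-trans (Tw-cong (ρ b n) (ih (x₀ , x₀∈) shorter (pair s t (not b)) ¬r))
          (≐-trans (Tw-Scale (ρ b n) col₀)
          (λ u i → c·-cong x (≋-sym (col-w u i)))))))
          where
          shorter : ℓ x₀ < ℓ (proj₁ w)
          shorter = subst (ℓ x₀ <_) (sym (trans (ℓ-cong w-factor) (additive-ρ min b n red)))
            (m<n+m (ℓ x₀) (n≢0⇒n>0 ne))
          Y≡ : Tw (ρ (not b) (suc n)) col₀ ≡ Tw (ρ b n) (T (pair s t (not b)) col₀)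
          Y≡ = trans (cong (λ v → Tw v col₀) (ρ-snoc (not b) n))
            (trans (Tw-++ (ρ (not (not b)) n) [ pair s t (not b) ] col₀)
                   (cong (λ c → Tw (ρ c n) (T (pair s t (not b)) col₀)) (not-involutive b)))
        finish : n ≢ 0 → Shape x₀∈ min n → T s (column w) ≐ Scale (column w)
        -- A full coset would contain s w in W^H; a blocked branch b would exclude w, which sits on
        -- it at height n > 0. So only a chain blocked at `not b` remains.
        finish ne (full br)       = ⊥-elim (¬sw (InWH-cong (~sym (f b)) (br b (suc n) ≤-refl)))
        finish ne (single _ dead) = dead-end ne (dead b)
        finish ne (chain r ¬r _ _ dead) = bool-cover
          (λ r → ¬ InWH (pair s t r ∷ x₀) → (∀ j → j ≤ n → ¬ InWH (ρ r (suc j) ++ x₀)) → T s (column w) ≐ Scale (column w)) b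
          (λ _ → dead-end ne) (λ ¬r _ → transport ne ¬r) r ¬r dead

    eigen : ∀ w → Eigen w
    eigen w = <-rec (λ k → ∀ w → ℓ (proj₁ w) ≡ k → Eigen w)
      (λ { k ih w refl → eigen-step w λ w′ lt → ih lt w′ refl }) (ℓ (proj₁ w)) w refl

    -- At s u the operator T_s returns the value at u (`above`), so an identity between columns
    -- evaluated at s u exchanges u with s u. For a descent it is evaluated at u as well, and the
    -- value at s u replaces the term R_{u,sw} by R_{su,w}.
    upDownSymmetric : UpDownSymmetric x R
    upDownSymmetric i u w _ _ u⋖ with position (IdxH.gen i) (proj₂ u)
    ... | lowers p lt = ⊥-elim (<-asym lt (subst (ℓ (proj₁ u) <_) (cong ℓ (lam-moves u p)) (⋖⇒< u (lamH (IdxH.gen i) u) u⋖)))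
    ... | fixes ¬p _  = ⊥-elim (<-irrefl (cong ℓ (sym (lam-stays u ¬p))) (⋖⇒< u (lamH (IdxH.gen i) u) u⋖))
    ... | raises su∈ lt = case-up , case-down , case-fixed
      where
      s = IdxH.gen i
      U = proj₁ u
      Mu = lamH s u
      Mw = lamH s w
      col-Mu : ∀ v → coeff (R Mu v) ≋ column v (s ∷ U)
      col-Mu v = ≋-trans (resp Mu (s ∷ U , su∈) v v (≡⇒~ (lam-moves u su∈)) ~refl) (≋-sym (column-≋ v (s ∷ U , su∈)))
      above : ∀ v → T s (column v) (s ∷ U) ≋ column v U
      above v = T-above (column-resp v) (proj₂ u) lt
      case-up : w ⋖ Mw → R u w ≈P R Mu Mw
      case-up w⋖ with lamView s w
      ... | stays _ e = ⊥-elim (<-irrefl (cong ℓ (sym e)) (⋖⇒< w Mw w⋖))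
      ... | moves p e = ≋-trans (≋-sym (column-≋ w u)) (≋-trans (≋-sym (above w))
              (≋-trans (≋-sym (recursion Mw s desc w (~sym back) (s ∷ U) su∈)) (≋-sym (col-Mu Mw))))
        where
        back : (s ∷ proj₁ Mw) ~ proj₁ w
        back = ∷-swap s (≡⇒~ e)
        desc : ℓ (s ∷ proj₁ Mw) < ℓ (proj₁ Mw)
        desc = subst (_< ℓ (proj₁ Mw)) (ℓ-cong (~sym back)) (⋖⇒< w Mw w⋖)
      case-down : Mw ⋖ w → R u w ≈P (q-1 *P R Mu w +P qP *P R Mu Mw)
      case-down ⋖w = ≋-trans (≋-sym (column-≋ w u))
        (≋-trans (rec U (proj₂ u)) (≋-trans (T-raises (column Mw) su∈ lt)
        (≋-trans (mix-cong (≋-sym (≋-trans (col-Mu w) (≋-trans (rec (s ∷ U) su∈) (above Mw)))) (≋-sym (col-Mu Mw)))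
        (≋-sym (coeff-mix (R Mu w) (R Mu Mw))))))
        where
        desc : ℓ (s ∷ proj₁ w) < ℓ (proj₁ w)
        desc = lam-⋖⇒descent w ⋖w
        rec : column w ≐ T s (column Mw)
        rec = recursion w s desc Mw (≡⇒~ (lam-moves w (InWH-descent desc (proj₂ w))))
      case-fixed : Mw ≈H w → R u w ≈P (fixFactor x *P R Mu w)
      case-fixed e with lamView s w
      ... | moves _ e′ = ⊥-elim (ℓ-∷-≢ s (proj₁ w) (ℓ-cong (~trans (≡⇒~ (sym e′)) e)))
      ... | stays ¬p _ = ≋-trans (≋-sym (column-≋ w u)) (≋-trans (≋-sym (above w))
              (≋-trans (eigen w s ¬p (s ∷ U) su∈)
              (≋-trans (c·-cong x (≋-sym (col-Mu w))) (≋-sym (coeff-fixFactor x (R Mu w))))))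

theorem3p8 : (lem : ExcludedMiddle 0ℓ) (S : Set) (m : S → S → Maybe ℕ) → IsCoxeterMatrix m → (H : S → Set) →
    let open Coxeter S m H lem in
    IsPirconSystem
    × (∀ (x : Xval) (ch : Choice) (R : WH → WH → Poly) → IsRFamily x ch R → UpDownSymmetric x R)
theorem3p8 lem S m cox H =
  PirconSystem.isPirconSystem lem S m cox H , RPolynomials.upDownSymmetric lem S m cox H
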